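{- For every integer $m \ge 2$, $d(m, 3m+1) \le 56$.
   Context: An integral point set in $\mathbb{R}^m$ is a finite set $\mathcal{P}$ of points of the $m$-dimensional Euclidean space $\mathbb{R}^m$ such that the Euclidean distance between any two points of $\mathcal{P}$ is an integer and $\mathcal{P}$ is not contained in an $(m-1)$-dimensional (affine) hyperplane. Its diameter is $\operatorname{diam}(\mathcal{P}) = \max_{P_1, P_2 \in \mathcal{P}} |P_1P_2|$. The function $d(m,n)$ is the minimal possible diameter of an integral point set of $n$ points in $\mathbb{R}^m$. -}

module Defs where

open import Data.Fin.Base using (Fin)
open import Data.Integer.Base as ℤ using (ℤ)
open import Data.Nat.Base as ℕ using (ℕ; _⊔_)
import Data.Nat.Properties as ℕ
open import Data.Product.Base using (∃-syntax; Σ-syntax; _×_; _,_; proj₁; proj₂)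
open import Data.Rational.Base as ℚ using (ℚ; 0ℚ; 1ℚ; ½; ∣_∣)
import Data.Rational.Properties as ℚ
open import Data.Rational.Solver using (module +-*-Solver)
open import Data.Vec.Functional using (Vector; foldr; zipWith)
open import Relation.Binary.PropositionalEquality
open import Relation.Nullary.Negation.Core using (¬_)

------------------------------------------------------------------------
-- Real numbers as Cauchy sequences of rationals, considered up to _≈ℝ_

IsCauchy : (ℕ → ℚ) → Set
IsCauchy s = ∀ ε → 0ℚ ℚ.< ε →
  ∃[ N ] ∀ i j → N ℕ.≤ i → N ℕ.≤ j → ∣ s i ℚ.- s j ∣ ℚ.< ε

record ℝ : Set where
  constructor mkℝ
  field
    seq    : ℕ → ℚ
    cauchy : IsCauchy seq

open ℝ public

infix 4 _≈ℝ_ _≤ℝ_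

_≈ℝ_ : ℝ → ℝ → Set
x ≈ℝ y = ∀ ε → 0ℚ ℚ.< ε →
  ∃[ N ] ∀ n → N ℕ.≤ n → ∣ seq x n ℚ.- seq y n ∣ ℚ.< ε

_≤ℝ_ : ℝ → ℝ → Set
x ≤ℝ y = ∀ ε → 0ℚ ℚ.< ε →
  ∃[ N ] ∀ n → N ℕ.≤ n → seq x n ℚ.< seq y n ℚ.+ ε

private
  module Identities where
    open +-*-Solver

    cancel : ∀ a b → a ℚ.+ (b ℚ.- a) ≡ b
    cancel = solve 2 (λ a b → a :+ (b :- a) := b) refl

    swap : ∀ b d i → b ℚ.* (d ℚ.* i) ≡ d ℚ.* (b ℚ.* i)
    swap = solve 3 (λ b d i → b :* (d :* i) := d :* (b :* i)) refl

    +-diff : ∀ a b a′ b′ →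
             (a ℚ.- a′) ℚ.+ (b ℚ.- b′) ≡ (a ℚ.+ b) ℚ.- (a′ ℚ.+ b′)
    +-diff = solve 4 (λ a b a′ b′ →
      (a :- a′) :+ (b :- b′) := (a :+ b) :- (a′ :+ b′)) refl

    *-diff : ∀ a b a′ b′ →
             a ℚ.* (b ℚ.- b′) ℚ.+ b′ ℚ.* (a ℚ.- a′) ≡ a ℚ.* b ℚ.- a′ ℚ.* b′
    *-diff = solve 4 (λ a b a′ b′ →
      a :* (b :- b′) :+ b′ :* (a :- a′) := a :* b :- a′ :* b′) refl

  open Identities

  0<½* : ∀ {ε} → 0ℚ ℚ.< ε → 0ℚ ℚ.< ½ ℚ.* ε
  0<½* {ε} 0<ε =
    subst (ℚ._< ½ ℚ.* ε) (ℚ.*-zeroʳ ½) (ℚ.*-monoʳ-<-pos ½ 0<ε)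

  halves : ∀ ε → ½ ℚ.* ε ℚ.+ ½ ℚ.* ε ≡ ε
  halves ε = trans (sym (ℚ.*-distribʳ-+ ε ½ ½)) (ℚ.*-identityˡ ε)

  ∣+∣<halves : ∀ {ε} p q → ∣ p ∣ ℚ.< ½ ℚ.* ε → ∣ q ∣ ℚ.< ½ ℚ.* ε →
               ∣ p ℚ.+ q ∣ ℚ.< ε
  ∣+∣<halves {ε} p q p< q< = subst (∣ p ℚ.+ q ∣ ℚ.<_) (halves ε)
    (ℚ.≤-<-trans (ℚ.∣p+q∣≤∣p∣+∣q∣ p q) (ℚ.+-mono-< p< q<))

  bounded : ∀ s → IsCauchy s →
    ∃[ B ] (0ℚ ℚ.< B × ∃[ N ] ∀ n → N ℕ.≤ n → ∣ s n ∣ ℚ.< B)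
  bounded s c = ∣ s N ∣ ℚ.+ 1ℚ
    , ℚ.+-mono-≤-< (ℚ.0≤∣p∣ (s N)) 0<1
    , N , bound
    where
    0<1 : 0ℚ ℚ.< 1ℚ
    0<1 = ℚ.positive⁻¹ 1ℚ
    N : ℕ
    N = proj₁ (c 1ℚ 0<1)
    bound : ∀ n → N ℕ.≤ n → ∣ s n ∣ ℚ.< ∣ s N ∣ ℚ.+ 1ℚ
    bound n N≤n = ℚ.≤-<-trans
      (subst (λ t → ∣ t ∣ ℚ.≤ ∣ s N ∣ ℚ.+ ∣ s n ℚ.- s N ∣)
        (cancel (s N) (s n))
        (ℚ.∣p+q∣≤∣p∣+∣q∣ (s N) (s n ℚ.- s N)))
      (ℚ.+-monoʳ-< ∣ s N ∣ (proj₂ (c 1ℚ 0<1) n N N≤n ℕ.≤-refl))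

  small-factor : ∀ B δ → 0ℚ ℚ.< B → 0ℚ ℚ.< δ →
    ∃[ η ] (0ℚ ℚ.< η × ∀ p q → ∣ p ∣ ℚ.< B → ∣ q ∣ ℚ.< η → ∣ p ℚ.* q ∣ ℚ.< δ)
  small-factor B δ 0<B 0<δ = η , 0<η , bound
    where
    instance
      B-pos : ℚ.Positive B
      B-pos = ℚ.positive 0<B
      B-nz : ℚ.NonZero B
      B-nz = ℚ.pos⇒nonZero B
    η : ℚ
    η = δ ℚ.* ℚ.1/ B
    0<η : 0ℚ ℚ.< η
    0<η = ℚ.positive⁻¹ η
      {{ℚ.pos*pos⇒pos δ {{ℚ.positive 0<δ}} (ℚ.1/ B) {{ℚ.1/pos⇒pos B}}}}
    open ℚ.≤-Reasoning
    bound : ∀ p q → ∣ p ∣ ℚ.< B → ∣ q ∣ ℚ.< η → ∣ p ℚ.* q ∣ ℚ.< δ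
    bound p q p< q< = begin-strict
      ∣ p ℚ.* q ∣           ≡⟨ ℚ.∣p*q∣≡∣p∣*∣q∣ p q ⟩
      ∣ p ∣ ℚ.* ∣ q ∣       ≤⟨ ℚ.*-monoʳ-≤-nonNeg ∣ q ∣ {{ℚ.∣-∣-nonNeg q}} (ℚ.<⇒≤ p<) ⟩
      B ℚ.* ∣ q ∣           <⟨ ℚ.*-monoʳ-<-pos B q< ⟩
      B ℚ.* (δ ℚ.* ℚ.1/ B)  ≡⟨ swap B δ (ℚ.1/ B) ⟩
      δ ℚ.* (B ℚ.* ℚ.1/ B)  ≡⟨ cong (δ ℚ.*_) (ℚ.*-inverseʳ B) ⟩
      δ ℚ.* 1ℚ              ≡⟨ ℚ.*-identityʳ δ ⟩
      δ                     ∎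

  *-diff< : ∀ {a b a′ b′ ε} →
    ∣ a ℚ.* (b ℚ.- b′) ∣ ℚ.< ½ ℚ.* ε → ∣ b′ ℚ.* (a ℚ.- a′) ∣ ℚ.< ½ ℚ.* ε →
    ∣ a ℚ.* b ℚ.- a′ ℚ.* b′ ∣ ℚ.< ε
  *-diff< {a} {b} {a′} {b′} {ε} p< q< =
    subst (λ r → ∣ r ∣ ℚ.< ε) (*-diff a b a′ b′)
      (∣+∣<halves (a ℚ.* (b ℚ.- b′)) (b′ ℚ.* (a ℚ.- a′)) p< q<)

  -- abstract, as otherwise checking the records below normalises these proofs
  abstract
    const-cauchy : ∀ q → IsCauchy (λ _ → q)
    const-cauchy q ε 0<ε =
      0 , λ _ _ _ _ → subst (λ r → ∣ r ∣ ℚ.< ε) (sym (ℚ.+-inverseʳ q)) 0<ε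

    +-cauchy : ∀ s t → IsCauchy s → IsCauchy t → IsCauchy (λ n → s n ℚ.+ t n)
    +-cauchy s t c d ε 0<ε =
      let M , f = c (½ ℚ.* ε) (0<½* 0<ε)
          N , g = d (½ ℚ.* ε) (0<½* 0<ε)
      in M ⊔ N , λ i j ≤i ≤j → subst (λ r → ∣ r ∣ ℚ.< ε)
          (+-diff (s i) (t i) (s j) (t j))
          (∣+∣<halves (s i ℚ.- s j) (t i ℚ.- t j)
            (f i j (ℕ.m⊔n≤o⇒m≤o M N ≤i) (ℕ.m⊔n≤o⇒m≤o M N ≤j))
            (g i j (ℕ.m⊔n≤o⇒n≤o M N ≤i) (ℕ.m⊔n≤o⇒n≤o M N ≤j)))

    neg-cauchy : ∀ s → IsCauchy s → IsCauchy (λ n → ℚ.- s n)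
    neg-cauchy s c ε 0<ε =
      let N , f = c ε 0<ε
      in N , λ i j ≤i ≤j → subst (ℚ._< ε)
          (trans (sym (ℚ.∣-p∣≡∣p∣ (s i ℚ.- s j))) (cong ∣_∣ (ℚ.neg-distrib-+ (s i) (ℚ.- s j))))
          (f i j ≤i ≤j)

    *-cauchy : ∀ s t → IsCauchy s → IsCauchy t → IsCauchy (λ n → s n ℚ.* t n)
    *-cauchy s t c d ε 0<ε =
      let A , 0<A , K , s<A = bounded s c
          B , 0<B , L , t<B = bounded t d
          η , 0<η , small-s = small-factor A (½ ℚ.* ε) 0<A (0<½* 0<ε)
          θ , 0<θ , small-t = small-factor B (½ ℚ.* ε) 0<B (0<½* 0<ε)
          M , f = c θ 0<θ
          N , g = d η 0<η
      in (K ⊔ L) ⊔ (M ⊔ N) , λ i j ≤i ≤j →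
        let KL≤i = ℕ.m⊔n≤o⇒m≤o (K ⊔ L) (M ⊔ N) ≤i
            KL≤j = ℕ.m⊔n≤o⇒m≤o (K ⊔ L) (M ⊔ N) ≤j
            MN≤i = ℕ.m⊔n≤o⇒n≤o (K ⊔ L) (M ⊔ N) ≤i
            MN≤j = ℕ.m⊔n≤o⇒n≤o (K ⊔ L) (M ⊔ N) ≤j
        in *-diff< {s i} {t i} {s j} {t j} {ε}
          (small-s (s i) (t i ℚ.- t j) (s<A i (ℕ.m⊔n≤o⇒m≤o K L KL≤i))
            (g i j (ℕ.m⊔n≤o⇒n≤o M N MN≤i) (ℕ.m⊔n≤o⇒n≤o M N MN≤j)))
          (small-t (t j) (s i ℚ.- s j) (t<B j (ℕ.m⊔n≤o⇒n≤o K L KL≤j))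
            (f i j (ℕ.m⊔n≤o⇒m≤o M N MN≤i) (ℕ.m⊔n≤o⇒m≤o M N MN≤j)))

fromℚ : ℚ → ℝ
fromℚ q = mkℝ (λ _ → q) (const-cauchy q)

fromℤ : ℤ → ℝ
fromℤ k = fromℚ (k ℚ./ 1)

0ℝ : ℝ
0ℝ = fromℚ 0ℚ

infixl 6 _+ℝ_ _-ℝ_
infixl 7 _*ℝ_
infix  8 -ℝ_

_+ℝ_ : ℝ → ℝ → ℝ
x +ℝ y = mkℝ (λ n → seq x n ℚ.+ seq y n) (+-cauchy (seq x) (seq y) (cauchy x) (cauchy y))

-ℝ_ : ℝ → ℝ
-ℝ x = mkℝ (λ n → ℚ.- seq x n) (neg-cauchy (seq x) (cauchy x))

_-ℝ_ : ℝ → ℝ → ℝ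
x -ℝ y = x +ℝ (-ℝ y)

_*ℝ_ : ℝ → ℝ → ℝ
x *ℝ y = mkℝ (λ n → seq x n ℚ.* seq y n) (*-cauchy (seq x) (seq y) (cauchy x) (cauchy y))

------------------------------------------------------------------------
-- Euclidean space

infix 4 _≋_
infixl 7 _∙_

_≋_ : ∀ {m} → Vector ℝ m → Vector ℝ m → Set
p ≋ q = ∀ c → p c ≈ℝ q c

_∙_ : ∀ {m} → Vector ℝ m → Vector ℝ m → ℝ
p ∙ q = foldr _+ℝ_ 0ℝ (zipWith _*ℝ_ p q)

IsSqrt : ℝ → ℝ → Set
IsSqrt x r = 0ℝ ≤ℝ r × r *ℝ r ≈ℝ x

-- The graph of the distance function: r = √ Σ_c (p_c - q_c)²
IsDistance : ∀ {m} → Vector ℝ m → Vector ℝ m → ℝ → Set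
IsDistance p q r = IsSqrt (v ∙ v) r
  where v = zipWith _-ℝ_ p q

record Hyperplane (m : ℕ) : Set where
  field
    normal    : Vector ℝ m
    offset    : ℝ
    normal≉0  : ¬ (normal ≋ λ _ → 0ℝ)

infix 4 _∈ᴴ_

_∈ᴴ_ : ∀ {m} → Vector ℝ m → Hyperplane m → Set
p ∈ᴴ H = normal ∙ p ≈ℝ offset
  where open Hyperplane H

------------------------------------------------------------------------
-- Integral point sets; a set of n points is an injective family over Fin n

record IsIntegralPointSet {m n : ℕ} (P : Fin n → Vector ℝ m) : Set where
  field
    distinct      : ∀ {i j} → P i ≋ P j → i ≡ j
    integral      : ∀ i j → ∃[ k ] IsDistance (P i) (P j) (fromℤ k)
    notHyperplane : ¬ (Σ[ H ∈ Hyperplane m ] ∀ i → P i ∈ᴴ H)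

record IsDiameter {m n : ℕ} (P : Fin n → Vector ℝ m) (δ : ℝ) : Set where
  field
    attained : ∃[ i ] ∃[ j ] IsDistance (P i) (P j) δ
    maximal  : ∀ i j r → IsDistance (P i) (P j) r → r ≤ℝ δ

-- The graph of the function d: δ = d(m,n). That such a δ exists, when there
-- are integral point sets of n points at all, is an instance of the
-- (classical) least number principle.
record IsMinimalDiameter (m n : ℕ) (δ : ℝ) : Set where
  field
    attained : Σ[ P ∈ (Fin n → Vector ℝ m) ] (IsIntegralPointSet P × IsDiameter P δ)
    minimal  : ∀ (P : Fin n → Vector ℝ m) ε →
               IsIntegralPointSet P → IsDiameter P ε → δ ≤ℝ ε

-- Take m rays from a common apex with a 60° angle between any two of them, put
-- points at distances 7, 15 and 40 from the apex on each ray, and add the apex.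
-- Points at distances a and b from the apex are |a − b| apart on the same ray
-- and √(a² + b² − ab) apart on different rays, which gives 13, 37 and 35 for the
-- three pairs of radii, so these 3m + 1 points have diameter 40. The directions
-- of the rays are edges of a regular simplex: in suitable coordinates they are
-- rational multiples of square roots of rational numbers. The minimum exists
-- because the diameter of an integral point set is a natural number.

module Submission where

open import Defs
open import Axiom.ExcludedMiddle using (ExcludedMiddle)
open import Data.Empty using (⊥-elim)
open import Data.Fin.Base using (Fin; zero; suc)
open import Data.Fin.Patterns using (0F; 2F; 3F)
import Data.Fin.Properties as Fin
open import Data.Integer.Base as ℤ using (+_; +[1+_]; -[1+_])
import Data.Integer.Properties as ℤ
import Data.Integer.Tactic.RingSolver as ℤ-Solver
open import Data.Nat.Base as ℕ using (ℕ; zero; suc; _+_; _*_; _≤_; _⊔_)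
open import Data.Nat.Coprimality using (1-coprimeTo)
open import Data.Nat.Induction using (<-rec)
import Data.Nat.Properties as ℕ
open import Data.Product.Base using (∃-syntax; Σ-syntax; _×_; _,_; proj₁; proj₂)
open import Data.Rational.Base as ℚ using (ℚ; mkℚ; 0ℚ; 1ℚ; ½; ∣_∣; toℚᵘ)
import Data.Rational.Properties as ℚ
open import Data.Rational.Solver using (module +-*-Solver)
import Data.Rational.Unnormalised.Base as ℚᵘ
import Data.Rational.Unnormalised.Properties as ℚᵘ
open import Data.Sum.Base using (_⊎_; inj₁; inj₂)
open import Data.Sum.Function.Propositional using (_⊎-↔_)
open import Data.Vec.Base using (lookup; []; _∷_)
open import Data.Vec.Functional using (Vector; zipWith)
open import Function.Base using (_∘_)
open import Function.Bundles using (_↔_; module Inverse; module Injection)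
open import Function.Construct.Composition using (_↔-∘_)
open import Function.Construct.Identity using (↔-id)
open import Function.Properties.Inverse using (↔⇒↣)
open import Level using (0ℓ)
open import Relation.Binary.PropositionalEquality
open import Relation.Nullary using (¬_; yes; no)
open import Relation.Nullary.Decidable using (from-yes; _→-dec_)

open +-*-Solver using (solve; _:+_; _:*_; _:-_; :-_; _:=_; con)

-- Inequalities over ℚ

square-mono-≤ : ∀ {p q} → 0ℚ ℚ.≤ p → p ℚ.≤ q → p ℚ.* p ℚ.≤ q ℚ.* q
square-mono-≤ {p} {q} 0≤p p≤q = ℚ.≤-trans
  (ℚ.*-monoʳ-≤-nonNeg p {{ℚ.nonNegative 0≤p}} p≤q)
  (ℚ.*-monoˡ-≤-nonNeg q {{ℚ.nonNegative (ℚ.≤-trans 0≤p p≤q)}} p≤q)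

square-cancel-< : ∀ {p q} → 0ℚ ℚ.≤ q → p ℚ.* p ℚ.< q ℚ.* q → p ℚ.< q
square-cancel-< {p} {q} 0≤q pp<qq = ℚ.≰⇒> λ q≤p →
  ℚ.<-irrefl refl (ℚ.<-≤-trans pp<qq (square-mono-≤ 0≤q q≤p))

0<p*q : ∀ {p q} → 0ℚ ℚ.< p → 0ℚ ℚ.< q → 0ℚ ℚ.< p ℚ.* q
0<p*q {p} {q} 0<p 0<q = ℚ.positive⁻¹ (p ℚ.* q)
  {{ℚ.pos*pos⇒pos p {{ℚ.positive 0<p}} q {{ℚ.positive 0<q}}}}

0≤p*q : ∀ {p q} → 0ℚ ℚ.≤ p → 0ℚ ℚ.≤ q → 0ℚ ℚ.≤ p ℚ.* q
0≤p*q {p} {q} 0≤p 0≤q = ℚ.nonNegative⁻¹ (p ℚ.* q)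
  {{ℚ.nonNeg*nonNeg⇒nonNeg p {{ℚ.nonNegative 0≤p}} q {{ℚ.nonNegative 0≤q}}}}

0<½ : 0ℚ ℚ.< ½
0<½ = ℚ.positive⁻¹ ½

0<1 : 0ℚ ℚ.< 1ℚ
0<1 = ℚ.positive⁻¹ 1ℚ

square-neg : ∀ p → ℚ.- p ℚ.* ℚ.- p ≡ p ℚ.* p
square-neg = solve 1 (λ p → :- p :* :- p := p :* p) refl

½p+½p≡p : ∀ p → ½ ℚ.* p ℚ.+ ½ ℚ.* p ≡ p
½p+½p≡p = solve 1 (λ p → con ½ :* p :+ con ½ :* p := p) refl

p-q+q≡p : ∀ p q → p ℚ.- q ℚ.+ q ≡ p
p-q+q≡p = solve 2 (λ p q → p :- q :+ q := p) refl

p≤q⇒0≤q-p : ∀ {p q} → p ℚ.≤ q → 0ℚ ℚ.≤ q ℚ.- p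
p≤q⇒0≤q-p {p} {q} p≤q =
  subst (ℚ._≤ q ℚ.- p) (ℚ.+-inverseʳ p) (ℚ.+-monoˡ-≤ (ℚ.- p) p≤q)

p-q<r⇒p<q+r : ∀ {p q r} → p ℚ.- q ℚ.< r → p ℚ.< q ℚ.+ r
p-q<r⇒p<q+r {p} {q} {r} p-q<r =
  subst₂ ℚ._<_ (p-q+q≡p p q) (ℚ.+-comm r q) (ℚ.+-monoˡ-< q p-q<r)

p<q+r⇒p-q<r : ∀ {p q r} → p ℚ.< q ℚ.+ r → p ℚ.- q ℚ.< r
p<q+r⇒p-q<r {p} {q} {r} p<q+r = subst (p ℚ.- q ℚ.<_) (cancel q r) (ℚ.+-monoˡ-< (ℚ.- q) p<q+r)
  where
  cancel : ∀ q r → q ℚ.+ r ℚ.- q ≡ r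
  cancel = solve 2 (λ q r → q :+ r :- q := r) refl

p≤∣p∣ : ∀ p → p ℚ.≤ ∣ p ∣
p≤∣p∣ p with ℚ.≤-total 0ℚ p
... | inj₁ 0≤p = ℚ.≤-reflexive (sym (ℚ.0≤p⇒∣p∣≡p 0≤p))
... | inj₂ p≤0 = ℚ.≤-trans p≤0 (ℚ.0≤∣p∣ p)

∣p-q∣<r : ∀ {p q r} → p ℚ.- q ℚ.< r → q ℚ.- p ℚ.< r → ∣ p ℚ.- q ∣ ℚ.< r
∣p-q∣<r {p} {q} {r} p-q<r q-p<r with ℚ.∣p∣≡p∨∣p∣≡-p (p ℚ.- q)
... | inj₁ eq = subst (ℚ._< r) (sym eq) p-q<r
... | inj₂ eq = subst (ℚ._< r) (sym (trans eq (neg p q))) q-p<r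
  where
  neg : ∀ p q → ℚ.- (p ℚ.- q) ≡ q ℚ.- p
  neg = solve 2 (λ p q → :- (p :- q) := q :- p) refl

-- The unit fractions 1/(k+1)

unitFraction : ℕ → ℚ
unitFraction k = mkℚ (+ 1) k (1-coprimeTo (suc k))

archimedean : ∀ {ε} → 0ℚ ℚ.< ε → ∃[ N ] unitFraction N ℚ.< ε
-- Here ε = (n + 1)/(d + 1) ≥ 1/(d + 1) > 1/(d + 2), and the last fraction is
-- `unitFraction (suc d)`.
archimedean {mkℚ +[1+ n ] d _} _ = suc d , ℚ.*<* (ℤ.+<+ (ℕ.≤-trans
  (ℕ.s≤s (ℕ.≤-reflexive (ℕ.+-identityʳ (suc d)))) (ℕ.m≤m+n (suc (suc d)) _)))
archimedean {mkℚ (+ 0) _ _} 0<ε = ⊥-elim (ℚ.<-irrefl refl (subst (0ℚ ℚ.<_) (ℚ.↥p≡0⇒p≡0 _ refl) 0<ε))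
archimedean {mkℚ ℤ.-[1+ _ ] _ _} (ℚ.*<* ())

unitFraction-antimono : ∀ {i j} → i ℕ.≤ j → unitFraction j ℚ.≤ unitFraction i
unitFraction-antimono i≤j = ℚ.*≤* (ℤ.*-monoˡ-≤-nonNeg (+ 1) (ℤ.+≤+ (ℕ.s≤s i≤j)))

-- 1/((k + 1)(k + 2)) = 1/(k + 1) - 1/(k + 2). This recurrence drives the inductions on squared
-- lengths: ring identities there are arranged to expose `b * u + u`, which then becomes `b`. In
-- unnormalised rationals it is a polynomial identity in d = k + 1.
unitFraction-suc : ∀ k → unitFraction k ℚ.* unitFraction (suc k) ℚ.+ unitFraction (suc k) ≡ unitFraction k
unitFraction-suc k = ℚ.toℚᵘ-injective (begin-equality
  toℚᵘ (b ℚ.* b′ ℚ.+ b′)             ≃⟨ ℚ.toℚᵘ-homo-+ (b ℚ.* b′) b′ ⟩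
  toℚᵘ (b ℚ.* b′) ℚᵘ.+ toℚᵘ b′       ≃⟨ ℚᵘ.+-congˡ (toℚᵘ b′) (ℚ.toℚᵘ-homo-* b b′) ⟩
  toℚᵘ b ℚᵘ.* toℚᵘ b′ ℚᵘ.+ toℚᵘ b′   ≃⟨ ℚᵘ.*≡* (cross (+ suc k)) ⟩
  toℚᵘ b                             ∎)
  where
  open ℚᵘ.≤-Reasoning
  b = unitFraction k
  b′ = unitFraction (suc k)
  cross : ∀ d → ((+ 1 ℤ.* + 1) ℤ.* (+ 1 ℤ.+ d) ℤ.+ + 1 ℤ.* (d ℤ.* (+ 1 ℤ.+ d))) ℤ.* d
              ≡ + 1 ℤ.* ((d ℤ.* (+ 1 ℤ.+ d)) ℤ.* (+ 1 ℤ.+ d))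
  cross = ℤ-Solver.solve-∀

0<unitFraction : ∀ k → 0ℚ ℚ.< unitFraction k
0<unitFraction k = ℚ.positive⁻¹ (unitFraction k)

unitFraction≤1 : ∀ k → unitFraction k ℚ.≤ 1ℚ
unitFraction≤1 k = unitFraction-antimono ℕ.z≤n

-- Null sequences

-- `x ≈ℝ y` unfolds to this for the termwise difference, so closure properties of null sequences
-- give properties of real equality directly.
Null : (ℕ → ℚ) → Set
Null f = ∀ ε → 0ℚ ℚ.< ε → ∃[ N ] ∀ n → N ℕ.≤ n → ∣ f n ∣ ℚ.< ε

Bounded : (ℕ → ℚ) → Set
Bounded f = ∃[ B ] (0ℚ ℚ.< B × ∃[ N ] ∀ n → N ℕ.≤ n → ∣ f n ∣ ℚ.< B)

null-resp : ∀ {f g} → f ≗ g → Null f → Null g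
null-resp f≗g null ε 0<ε =
  let N , f<ε = null ε 0<ε
  in N , λ n N≤n → subst (λ q → ∣ q ∣ ℚ.< ε) (f≗g n) (f<ε n N≤n)

null-0 : Null (λ _ → 0ℚ)
null-0 ε 0<ε = 0 , λ _ _ → 0<ε

null-+ : ∀ {f g} → Null f → Null g → Null (λ n → f n ℚ.+ g n)
null-+ {f} {g} null-f null-g ε 0<ε =
  let M , f<ε = null-f (½ ℚ.* ε) (0<p*q 0<½ 0<ε)
      N , g<ε = null-g (½ ℚ.* ε) (0<p*q 0<½ 0<ε)
  in M ⊔ N , λ n ≤n → ℚ.≤-<-trans (ℚ.∣p+q∣≤∣p∣+∣q∣ (f n) (g n))
    (subst (∣ f n ∣ ℚ.+ ∣ g n ∣ ℚ.<_) (½p+½p≡p ε)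
      (ℚ.+-mono-< (f<ε n (ℕ.m⊔n≤o⇒m≤o M N ≤n)) (g<ε n (ℕ.m⊔n≤o⇒n≤o M N ≤n))))

null-* : ∀ {f g} → Null f → Bounded g → Null (λ n → f n ℚ.* g n)
null-* {f} {g} null-f (B , 0<B , M , g<B) ε 0<ε =
  let N , f<η = null-f η 0<η
  in M ⊔ N , λ n ≤n → product< (f n) (g n)
       (f<η n (ℕ.m⊔n≤o⇒n≤o M N ≤n)) (g<B n (ℕ.m⊔n≤o⇒m≤o M N ≤n))
  where
  instance
    B-pos : ℚ.Positive B
    B-pos = ℚ.positive 0<B
    B-nz : ℚ.NonZero B
    B-nz = ℚ.pos⇒nonZero B
  η : ℚ
  -- Where |g| < B, it suffices to push |f| below ε/B.
  η = ε ℚ.* ℚ.1/ B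
  0<η : 0ℚ ℚ.< η
  0<η = 0<p*q 0<ε (ℚ.positive⁻¹ (ℚ.1/ B) {{ℚ.1/pos⇒pos B}})
  open ℚ.≤-Reasoning
  product< : ∀ p q → ∣ p ∣ ℚ.< η → ∣ q ∣ ℚ.< B → ∣ p ℚ.* q ∣ ℚ.< ε
  product< p q p<η q<B = begin-strict
    ∣ p ℚ.* q ∣           ≡⟨ ℚ.∣p*q∣≡∣p∣*∣q∣ p q ⟩
    ∣ p ∣ ℚ.* ∣ q ∣       ≤⟨ ℚ.*-monoˡ-≤-nonNeg ∣ p ∣ {{ℚ.∣-∣-nonNeg p}} (ℚ.<⇒≤ q<B) ⟩
    ∣ p ∣ ℚ.* B           <⟨ ℚ.*-monoˡ-<-pos B p<η ⟩
    ε ℚ.* ℚ.1/ B ℚ.* B    ≡⟨ ℚ.*-assoc ε (ℚ.1/ B) B ⟩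
    ε ℚ.* (ℚ.1/ B ℚ.* B)  ≡⟨ cong (ε ℚ.*_) (ℚ.*-inverseˡ B) ⟩
    ε ℚ.* 1ℚ              ≡⟨ ℚ.*-identityʳ ε ⟩
    ε                     ∎

null-squeeze : ∀ {f g} → (∀ n → ∣ g n ∣ ℚ.≤ f n) → Null f → Null g
null-squeeze {f} ∣g∣≤f null ε 0<ε =
  let N , f<ε = null ε 0<ε
  in N , λ n N≤n → ℚ.≤-<-trans (ℚ.≤-trans (∣g∣≤f n) (p≤∣p∣ (f n))) (f<ε n N≤n)

null⇒bounded : ∀ {f} → Null f → Bounded f
null⇒bounded null = 1ℚ , 0<1 , null 1ℚ 0<1

const-bounded : ∀ q → Bounded (λ _ → q)
const-bounded q = ∣ q ∣ ℚ.+ 1ℚ , ℚ.+-mono-≤-< (ℚ.0≤∣p∣ q) 0<1 , 0 , λ _ _ →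
  subst (ℚ._< ∣ q ∣ ℚ.+ 1ℚ) (ℚ.+-identityʳ ∣ q ∣) (ℚ.+-monoʳ-< ∣ q ∣ 0<1)

bounded-+ : ∀ {f g} → Bounded f → Bounded g → Bounded (λ n → f n ℚ.+ g n)
bounded-+ {f} {g} (A , 0<A , M , f<A) (B , 0<B , N , g<B) =
  A ℚ.+ B , ℚ.+-mono-< 0<A 0<B , M ⊔ N , λ n ≤n →
    ℚ.≤-<-trans (ℚ.∣p+q∣≤∣p∣+∣q∣ (f n) (g n))
      (ℚ.+-mono-< (f<A n (ℕ.m⊔n≤o⇒m≤o M N ≤n)) (g<B n (ℕ.m⊔n≤o⇒n≤o M N ≤n)))

cauchy⇒bounded : ∀ {s} → IsCauchy s → Bounded s
cauchy⇒bounded {s} c =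
  let N , close = c 1ℚ 0<1
      B , 0<B , _ , s<B = const-bounded (s N)
  in B ℚ.+ 1ℚ , ℚ.+-mono-< 0<B 0<1 , N , λ n N≤n →
    subst (λ q → ∣ q ∣ ℚ.< B ℚ.+ 1ℚ) (cancel (s N) (s n))
      (ℚ.≤-<-trans (ℚ.∣p+q∣≤∣p∣+∣q∣ (s N) (s n ℚ.- s N))
        (ℚ.+-mono-< (s<B 0 ℕ.z≤n) (close n N N≤n ℕ.≤-refl)))
  where
  cancel : ∀ p q → p ℚ.+ (q ℚ.- p) ≡ q
  cancel = solve 2 (λ p q → p :+ (q :- p) := q) refl

seq-bounded : ∀ x → Bounded (seq x)
seq-bounded x = cauchy⇒bounded (cauchy x)

unitFraction-null : Null unitFraction
unitFraction-null ε 0<ε =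
  let N , b<ε = archimedean 0<ε
  in N , λ n N≤n → ℚ.≤-<-trans (unitFraction-antimono N≤n) b<ε

-- Equality and order of real numbers

-- Real arithmetic is termwise, so this turns ring identities over ℚ into equalities of reals. The
-- reals are passed explicitly throughout, since the unfolded equality mentions only their sequences
-- and does not determine the Cauchy proofs.
≗⇒≈ℝ : ∀ {x y} → seq x ≗ seq y → x ≈ℝ y
≗⇒≈ℝ {x} {y} x≗y = null-resp
  (λ n → sym (trans (cong (ℚ._- seq y n) (x≗y n)) (ℚ.+-inverseʳ (seq y n)))) null-0

≈ℝ-refl : ∀ {x} → x ≈ℝ x
≈ℝ-refl {x} = ≗⇒≈ℝ {x} {x} λ _ → refl

≈ℝ-sym : ∀ {x y} → x ≈ℝ y → y ≈ℝ x
≈ℝ-sym {x} {y} x≈y = null-resp (λ n → flip (seq x n) (seq y n))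
  (null-* x≈y (const-bounded (ℚ.- 1ℚ)))
  where
  flip : ∀ p q → (p ℚ.- q) ℚ.* (ℚ.- 1ℚ) ≡ q ℚ.- p
  flip = solve 2 (λ p q → (p :- q) :* (:- con 1ℚ) := q :- p) refl

≈ℝ-trans : ∀ {x y z} → x ≈ℝ y → y ≈ℝ z → x ≈ℝ z
≈ℝ-trans {x} {y} {z} x≈y y≈z =
  null-resp (λ n → telescope (seq x n) (seq y n) (seq z n)) (null-+ x≈y y≈z)
  where
  telescope : ∀ p q r → (p ℚ.- q) ℚ.+ (q ℚ.- r) ≡ p ℚ.- r
  telescope = solve 3 (λ p q r → (p :- q) :+ (q :- r) := p :- r) refl

+ℝ-cong : ∀ {x x′ y y′} → x ≈ℝ x′ → y ≈ℝ y′ → x +ℝ y ≈ℝ x′ +ℝ y′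
+ℝ-cong {x} {x′} {y} {y′} x≈x′ y≈y′ =
  null-resp (λ n → +-diff (seq x n) (seq x′ n) (seq y n) (seq y′ n)) (null-+ x≈x′ y≈y′)
  where
  +-diff : ∀ p p′ q q′ → (p ℚ.- p′) ℚ.+ (q ℚ.- q′) ≡ (p ℚ.+ q) ℚ.- (p′ ℚ.+ q′)
  +-diff = solve 4 (λ p p′ q q′ → (p :- p′) :+ (q :- q′) := (p :+ q) :- (p′ :+ q′)) refl

*ℝ-cong : ∀ {x x′ y y′} → x ≈ℝ x′ → y ≈ℝ y′ → x *ℝ y ≈ℝ x′ *ℝ y′
*ℝ-cong {x} {x′} {y} {y′} x≈x′ y≈y′ =
  null-resp (λ n → *-diff (seq x n) (seq x′ n) (seq y n) (seq y′ n))
    (null-+ (null-* x≈x′ (seq-bounded y)) (null-* y≈y′ (seq-bounded x′)))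
  where
  *-diff : ∀ p p′ q q′ → (p ℚ.- p′) ℚ.* q ℚ.+ (q ℚ.- q′) ℚ.* p′ ≡ p ℚ.* q ℚ.- p′ ℚ.* q′
  *-diff = solve 4 (λ p p′ q q′ →
    (p :- p′) :* q :+ (q :- q′) :* p′ := p :* q :- p′ :* q′) refl

≈ℝ⇒≤ℝ : ∀ {x y} → x ≈ℝ y → x ≤ℝ y
≈ℝ⇒≤ℝ {x} {y} x≈y ε 0<ε =
  let N , close = x≈y ε 0<ε
  in N , λ n N≤n → p-q<r⇒p<q+r (ℚ.≤-<-trans (p≤∣p∣ (seq x n ℚ.- seq y n)) (close n N≤n))

≤ℝ-trans : ∀ {x y z} → x ≤ℝ y → y ≤ℝ z → x ≤ℝ z
≤ℝ-trans {x} {y} {z} x≤y y≤z ε 0<ε =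
  let M , x<y = x≤y (½ ℚ.* ε) (0<p*q 0<½ 0<ε)
      N , y<z = y≤z (½ ℚ.* ε) (0<p*q 0<½ 0<ε)
  in M ⊔ N , λ n ≤n →
    subst (seq x n ℚ.<_) (halves (seq z n))
      (ℚ.<-trans (x<y n (ℕ.m⊔n≤o⇒m≤o M N ≤n))
        (ℚ.+-monoˡ-< (½ ℚ.* ε) (y<z n (ℕ.m⊔n≤o⇒n≤o M N ≤n))))
  where
  halves : ∀ q → q ℚ.+ ½ ℚ.* ε ℚ.+ ½ ℚ.* ε ≡ q ℚ.+ ε
  halves q = trans (ℚ.+-assoc q _ _) (cong (q ℚ.+_) (½p+½p≡p ε))

fromℚ-mono-≤ : ∀ {p q} → p ℚ.≤ q → fromℚ p ≤ℝ fromℚ q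
fromℚ-mono-≤ {p} {q} p≤q ε 0<ε = 0 , λ _ _ →
  subst (ℚ._< q ℚ.+ ε) (ℚ.+-identityʳ p) (ℚ.+-mono-≤-< p≤q 0<ε)

fromℚ-injective : ∀ {p q} → fromℚ p ≈ℝ fromℚ q → p ≡ q
fromℚ-injective {p} {q} p≈q with p ℚ.≟ q
... | yes p≡q = p≡q
... | no  p≢q = ⊥-elim (ℚ.<-irrefl refl (proj₂ (p≈q ∣ p ℚ.- q ∣ 0<∣p-q∣) _ ℕ.≤-refl))
  where
  0<∣p-q∣ : 0ℚ ℚ.< ∣ p ℚ.- q ∣
  0<∣p-q∣ = ℚ.≰⇒> λ ∣p-q∣≤0 → p≢q (trans (sym (p-q+q≡p p q)) (trans
    (cong (ℚ._+ q) (ℚ.∣p∣≡0⇒p≡0 _ (ℚ.≤-antisym ∣p-q∣≤0 (ℚ.0≤∣p∣ (p ℚ.- q)))))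
    (ℚ.+-identityˡ q)))

-- Termwise, y only exceeds some -ε/4. Still (q + ε)² = q² + ε²/2 + 2ε(q + ε/4) > q² + ε²/2 > p²,
-- and q + ε ≥ 0, so p < q + ε. The tolerances ε/4 and ε²/2 are chosen for this expansion.
square-cancel-≤ℝ : ∀ {x y} → 0ℝ ≤ℝ y → x *ℝ x ≤ℝ y *ℝ y → x ≤ℝ y
square-cancel-≤ℝ {x} {y} 0≤y xx≤yy ε 0<ε =
  let M , y>-¼ε = 0≤y ¼ε (0<p*q 0<½ (0<p*q 0<½ 0<ε))
      N , xx<yy = xx≤yy (½ ℚ.* (ε ℚ.* ε)) (0<p*q 0<½ (0<p*q 0<ε 0<ε))
  in M ⊔ N , λ n ≤n → below (seq x n) (seq y n)
      (y>-¼ε n (ℕ.m⊔n≤o⇒m≤o M N ≤n)) (xx<yy n (ℕ.m⊔n≤o⇒n≤o M N ≤n))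
  where
  ¼ε ¾ε : ℚ
  ¼ε = ½ ℚ.* (½ ℚ.* ε)
  ¾ε = (1ℚ ℚ.- ½ ℚ.* ½) ℚ.* ε
  expand : ∀ q ε → q ℚ.* q ℚ.+ ½ ℚ.* (ε ℚ.* ε) ℚ.+ (ε ℚ.+ ε) ℚ.* (q ℚ.+ ½ ℚ.* (½ ℚ.* ε))
                 ≡ (q ℚ.+ ε) ℚ.* (q ℚ.+ ε)
  expand = solve 2 (λ q ε → q :* q :+ con ½ :* (ε :* ε)
      :+ (ε :+ ε) :* (q :+ con ½ :* (con ½ :* ε)) := (q :+ ε) :* (q :+ ε)) refl
  split : ∀ q ε → q ℚ.+ ½ ℚ.* (½ ℚ.* ε) ℚ.+ (1ℚ ℚ.- ½ ℚ.* ½) ℚ.* ε ≡ q ℚ.+ ε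
  split = solve 2 (λ q ε → q :+ con ½ :* (con ½ :* ε) :+ con (1ℚ ℚ.- ½ ℚ.* ½) :* ε := q :+ ε) refl
  0≤¾ε : 0ℚ ℚ.≤ ¾ε
  0≤¾ε = 0≤p*q (ℚ.nonNegative⁻¹ (1ℚ ℚ.- ½ ℚ.* ½)) (ℚ.<⇒≤ 0<ε)
  below : ∀ p q → 0ℚ ℚ.< q ℚ.+ ¼ε → p ℚ.* p ℚ.< q ℚ.* q ℚ.+ ½ ℚ.* (ε ℚ.* ε) → p ℚ.< q ℚ.+ ε
  below p q 0<q+¼ε pp<qq = square-cancel-<
    (subst (0ℚ ℚ.≤_) (split q ε) (ℚ.+-mono-≤ (ℚ.<⇒≤ 0<q+¼ε) 0≤¾ε))
    (ℚ.<-trans pp<qq (subst₂ ℚ._<_ (ℚ.+-identityʳ _) (expand q ε)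
      (ℚ.+-monoʳ-< (q ℚ.* q ℚ.+ ½ ℚ.* (ε ℚ.* ε)) (0<p*q (ℚ.+-mono-< 0<ε 0<ε) 0<q+¼ε))))

+ℝ-cancelˡ : ∀ {x y z} → x ≈ℝ 0ℝ → x +ℝ y ≈ℝ z → y ≈ℝ z
+ℝ-cancelˡ {x} {y} {z} x≈0 x+y≈z =
  null-resp (λ n → cancel (seq x n) (seq y n) (seq z n))
    (null-+ x+y≈z (null-* x≈0 (const-bounded (ℚ.- 1ℚ))))
  where
  cancel : ∀ p q r → p ℚ.+ q ℚ.- r ℚ.+ (p ℚ.- 0ℚ) ℚ.* (ℚ.- 1ℚ) ≡ q ℚ.- r
  cancel = solve 3 (λ p q r → p :+ q :- r :+ (p :- con 0ℚ) :* (:- con 1ℚ) := q :- r) refl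

+ℝ-cancelʳ : ∀ {x y z} → y ≈ℝ 0ℝ → x +ℝ y ≈ℝ z → x ≈ℝ z
+ℝ-cancelʳ {x} {y} {z} y≈0 x+y≈z = +ℝ-cancelˡ {y} {x} {z} y≈0
  (null-resp (λ n → cong (ℚ._- seq z n) (ℚ.+-comm (seq x n) (seq y n))) x+y≈z)

*ℝ-zeroˡ : ∀ {x y} → x ≈ℝ 0ℝ → x *ℝ y ≈ℝ 0ℝ
*ℝ-zeroˡ {x} {y} x≈0 =
  null-resp (λ n → zeroed (seq x n) (seq y n)) (null-* x≈0 (seq-bounded y))
  where
  zeroed : ∀ p q → (p ℚ.- 0ℚ) ℚ.* q ≡ p ℚ.* q ℚ.- 0ℚ
  zeroed = solve 2 (λ p q → (p :- con 0ℚ) :* q := p :* q :- con 0ℚ) refl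

-- Square roots of rational numbers, by bisection

module Sqrt (q : ℚ) (0≤q : 0ℚ ℚ.≤ q) where

  width : ℕ → ℚ
  width zero    = 1ℚ ℚ.+ q
  width (suc k) = ½ ℚ.* width k

  0<width : ∀ k → 0ℚ ℚ.< width k
  0<width zero    = ℚ.+-mono-<-≤ 0<1 0≤q
  0<width (suc k) = 0<p*q 0<½ (0<width k)

  Bracket : ℕ → ℚ → Set
  Bracket k s = 0ℚ ℚ.≤ s × s ℚ.* s ℚ.≤ q × q ℚ.< (s ℚ.+ width k) ℚ.* (s ℚ.+ width k)

  bracket : ∀ k → ∃[ s ] Bracket k s
  -- The initial interval from 0 to 1 + q works because (1 + q)² = q + (1 + q + q²) > q.
  bracket zero = 0ℚ , ℚ.≤-refl , 0≤q ,
    subst (q ℚ.<_) (expand q) (subst (ℚ._< q ℚ.+ (1ℚ ℚ.+ (q ℚ.+ q ℚ.* q)))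
      (ℚ.+-identityʳ q) (ℚ.+-monoʳ-< q (ℚ.+-mono-<-≤ 0<1 (ℚ.+-mono-≤ 0≤q (0≤p*q 0≤q 0≤q)))))
    where
    expand : ∀ q → q ℚ.+ (1ℚ ℚ.+ (q ℚ.+ q ℚ.* q)) ≡ (0ℚ ℚ.+ (1ℚ ℚ.+ q)) ℚ.* (0ℚ ℚ.+ (1ℚ ℚ.+ q))
    expand = solve 1 (λ q → q :+ (con 1ℚ :+ (q :+ q :* q)) :=
      (con 0ℚ :+ (con 1ℚ :+ q)) :* (con 0ℚ :+ (con 1ℚ :+ q))) refl
  bracket (suc k) with bracket k
  ... | s , 0≤s , ss≤q , q< with (s ℚ.+ width (suc k)) ℚ.* (s ℚ.+ width (suc k)) ℚ.≤? q
  ...   | no  q≱ = s , 0≤s , ss≤q , ℚ.≰⇒> q≱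
  ...   | yes ≤q = s ℚ.+ width (suc k) , ℚ.+-mono-≤ 0≤s (ℚ.<⇒≤ (0<width (suc k))) , ≤q ,
    subst (λ t → q ℚ.< t ℚ.* t) (sym (trans (ℚ.+-assoc s _ _) (cong (s ℚ.+_) (½p+½p≡p (width k))))) q<

  lower : ℕ → ℚ
  lower k = proj₁ (bracket k)

  -- The geometric sequence is compared with the null sequence 1/(k + 1). The inductive step is ½b ≤
  -- b′, which follows from b = b·b′ + b′ and b ≤ 1.
  width≤ : ∀ k → width k ℚ.≤ (1ℚ ℚ.+ q) ℚ.* unitFraction k
  width≤ zero    = ℚ.≤-reflexive (sym (ℚ.*-identityʳ (1ℚ ℚ.+ q)))
  width≤ (suc k) = begin
    ½ ℚ.* width k                ≤⟨ ℚ.*-monoˡ-≤-nonNeg ½ (width≤ k) ⟩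
    ½ ℚ.* ((1ℚ ℚ.+ q) ℚ.* b)     ≡⟨ swap (1ℚ ℚ.+ q) b ⟩
    (1ℚ ℚ.+ q) ℚ.* (½ ℚ.* b)     ≤⟨ ℚ.*-monoˡ-≤-nonNeg (1ℚ ℚ.+ q) {{ℚ.nonNegative (ℚ.<⇒≤ (0<width 0))}} half≤ ⟩
    (1ℚ ℚ.+ q) ℚ.* b′            ∎
    where
    open ℚ.≤-Reasoning
    b = unitFraction k
    b′ = unitFraction (suc k)
    swap : ∀ p q → ½ ℚ.* (p ℚ.* q) ≡ p ℚ.* (½ ℚ.* q)
    swap = solve 2 (λ p q → con ½ :* (p :* q) := p :* (con ½ :* q)) refl
    half≤ : ½ ℚ.* b ℚ.≤ b′
    half≤ = begin
      ½ ℚ.* b                      ≡⟨ cong (½ ℚ.*_) (sym (unitFraction-suc k)) ⟩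
      ½ ℚ.* (b ℚ.* b′ ℚ.+ b′)      ≤⟨ ℚ.*-monoˡ-≤-nonNeg ½ (ℚ.+-monoˡ-≤ b′
                                        (ℚ.*-monoʳ-≤-nonNeg b′ (unitFraction≤1 k))) ⟩
      ½ ℚ.* (1ℚ ℚ.* b′ ℚ.+ b′)     ≡⟨ cong (λ r → ½ ℚ.* (r ℚ.+ b′)) (ℚ.*-identityˡ b′) ⟩
      ½ ℚ.* (b′ ℚ.+ b′)            ≡⟨ trans (ℚ.*-distribˡ-+ ½ b′ b′) (½p+½p≡p b′) ⟩
      b′                           ∎

  width-null : Null width
  width-null = null-squeeze
    (λ k → subst₂ ℚ._≤_ (sym (ℚ.0≤p⇒∣p∣≡p (ℚ.<⇒≤ (0<width k)))) (ℚ.*-comm (1ℚ ℚ.+ q) (unitFraction k)) (width≤ k))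
    (null-* unitFraction-null (const-bounded (1ℚ ℚ.+ q)))

  -- For all i and j, (lower i)² ≤ q < (lower j + width j)². Used in both orders, this bounds |lower
  -- i - lower j| without any monotonicity argument.
  lower-close : ∀ i j → lower i ℚ.< lower j ℚ.+ width j
  lower-close i j with bracket i | bracket j
  ... | _ , _ , ss≤q , _ | t , 0≤t , _ , q< = square-cancel-<
    (ℚ.+-mono-≤ 0≤t (ℚ.<⇒≤ (0<width j))) (ℚ.≤-<-trans ss≤q q<)

  abstract
    lower-cauchy : IsCauchy lower
    lower-cauchy ε 0<ε =
      let N , w<ε = width-null ε 0<ε
          close : ∀ i j → N ℕ.≤ j → lower i ℚ.- lower j ℚ.< ε
          close i j N≤j = ℚ.<-trans (p<q+r⇒p-q<r {lower i} {lower j} (lower-close i j))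
            (ℚ.≤-<-trans (p≤∣p∣ (width j)) (w<ε j N≤j))
      in N , λ i j N≤i N≤j → ∣p-q∣<r {lower i} {lower j} (close i j N≤j) (close j i N≤i)

  sqrt : ℝ
  sqrt = mkℝ lower lower-cauchy

  sqrt*sqrt : sqrt *ℝ sqrt ≈ℝ fromℚ q
  -- 0 ≤ q - s² ≤ (s + w)² - s² = w(2s + w), a null sequence times a bounded one.
  sqrt*sqrt = ≈ℝ-sym {fromℚ q} {sqrt *ℝ sqrt} (null-squeeze gap≤
    (null-* width-null (bounded-+ (bounded-+ lower-bounded lower-bounded) (null⇒bounded width-null))))
    where
    lower-bounded : Bounded lower
    lower-bounded = cauchy⇒bounded lower-cauchy
    expand : ∀ s w → (s ℚ.+ w) ℚ.* (s ℚ.+ w) ℚ.- s ℚ.* s ≡ w ℚ.* (s ℚ.+ s ℚ.+ w)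
    expand = solve 2 (λ s w → (s :+ w) :* (s :+ w) :- s :* s := w :* (s :+ s :+ w)) refl
    gap≤ : ∀ k → ∣ q ℚ.- lower k ℚ.* lower k ∣ ℚ.≤ width k ℚ.* (lower k ℚ.+ lower k ℚ.+ width k)
    gap≤ k with bracket k
    ... | s , _ , ss≤q , q< = subst₂ ℚ._≤_
      (sym (ℚ.0≤p⇒∣p∣≡p (p≤q⇒0≤q-p ss≤q))) (expand s (width k))
      (ℚ.+-monoˡ-≤ (ℚ.- (s ℚ.* s)) (ℚ.<⇒≤ q<))

open Sqrt using (sqrt; sqrt*sqrt)

-- Rational coordinates with respect to an orthogonal basis of irrational lengths √weight

-- This is (k + 2)/(2(k + 1)), the squared height of a regular (k + 1)-simplex with unit edges.
weight : ℕ → ℚ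
weight k = ½ ℚ.* (1ℚ ℚ.+ unitFraction k)

0<weight : ∀ k → 0ℚ ℚ.< weight k
0<weight k = 0<p*q 0<½ (ℚ.+-mono-< 0<1 (0<unitFraction k))

root : ℕ → ℝ
root k = sqrt (weight k) (ℚ.<⇒≤ (0<weight k))

root*root : ∀ k → root k *ℝ root k ≈ℝ fromℚ (weight k)
root*root k = sqrt*sqrt (weight k) (ℚ.<⇒≤ (0<weight k))

-- Coordinate number c is scaled by the root of `weight (k + c)`. The start `k` is a parameter so
-- that deleting the first coordinate leads to the same construction at `suc k`.
embed : ∀ {m} → ℕ → Vector ℚ m → Vector ℝ m
embed k p zero    = fromℚ (p zero) *ℝ root k
embed k p (suc c) = embed (suc k) (p ∘ suc) c

normSq : ∀ {m} → ℕ → Vector ℚ m → ℚ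
normSq {zero}  k p = 0ℚ
normSq {suc m} k p = p zero ℚ.* p zero ℚ.* weight k ℚ.+ normSq (suc k) (p ∘ suc)

-- Each coordinate contributes (p√w - q√w)² = (p - q)²w: the roots occur only squared, so squared
-- distances can be computed in ℚ.
embed-distSq : ∀ {m} k (p q : Vector ℚ m) → let v = zipWith _-ℝ_ (embed k p) (embed k q) in
               v ∙ v ≈ℝ fromℚ (normSq k (zipWith ℚ._-_ p q))
embed-distSq {zero}  k p q = ≗⇒≈ℝ {0ℝ} {0ℝ} λ _ → refl
embed-distSq {suc m} k p q =
  +ℝ-cong {v₀ *ℝ v₀} {fromℚ (d ℚ.* d ℚ.* weight k)}
    {v ∙ v} {fromℚ (normSq (suc k) (zipWith ℚ._-_ (p ∘ suc) (q ∘ suc)))}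
    (≈ℝ-trans {v₀ *ℝ v₀} {fromℚ (d ℚ.* d) *ℝ (s *ℝ s)} {fromℚ (d ℚ.* d ℚ.* weight k)}
      (≗⇒≈ℝ {v₀ *ℝ v₀} {fromℚ (d ℚ.* d) *ℝ (s *ℝ s)} λ n → factor (p zero) (q zero) (seq s n))
      (*ℝ-cong {fromℚ (d ℚ.* d)} {fromℚ (d ℚ.* d)} {s *ℝ s} {fromℚ (weight k)}
        (≈ℝ-refl {fromℚ (d ℚ.* d)}) (root*root k)))
    (embed-distSq (suc k) (p ∘ suc) (q ∘ suc))
  where
  v : Vector ℝ m
  v = zipWith _-ℝ_ (embed (suc k) (p ∘ suc)) (embed (suc k) (q ∘ suc))
  s v₀ : ℝ
  s = root k
  v₀ = embed k p zero -ℝ embed k q zero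
  d : ℚ
  d = p zero ℚ.- q zero
  factor : ∀ p q s → (p ℚ.* s ℚ.- q ℚ.* s) ℚ.* (p ℚ.* s ℚ.- q ℚ.* s)
                   ≡ (p ℚ.- q) ℚ.* (p ℚ.- q) ℚ.* (s ℚ.* s)
  factor = solve 3 (λ p q s → (p :* s :- q :* s) :* (p :* s :- q :* s)
                           := (p :- q) :* (p :- q) :* (s :* s)) refl

distSq-cong-0 : ∀ {m} (p q : Vector ℝ m) → p ≋ q →
                zipWith _-ℝ_ p q ∙ zipWith _-ℝ_ p q ≈ℝ 0ℝ
distSq-cong-0 {zero}  p q p≋q = ≈ℝ-refl {0ℝ}
distSq-cong-0 {suc m} p q p≋q =
  +ℝ-cong {v₀ *ℝ v₀} {0ℝ} {v ∙ v} {0ℝ} (*ℝ-zeroˡ {v₀} {v₀} v₀≈0)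
    (distSq-cong-0 (p ∘ suc) (q ∘ suc) (p≋q ∘ suc))
  where
  v = zipWith _-ℝ_ (p ∘ suc) (q ∘ suc)
  v₀ = p zero -ℝ q zero
  v₀≈0 : v₀ ≈ℝ 0ℝ
  v₀≈0 = null-resp (λ n → sym (ℚ.+-identityʳ (seq v₀ n))) (p≋q zero)

-- Serves twice: for the vanishing tail of the first direction, and for the apex, which lies at the
-- origin.
embed-0-orthogonal : ∀ {m} k (p : Vector ℚ m) (n : Vector ℝ m) →
                     (∀ c → p c ≡ 0ℚ) → n ∙ embed k p ≈ℝ 0ℝ
embed-0-orthogonal {zero}  k p n p≡0 = ≈ℝ-refl {0ℝ}
embed-0-orthogonal {suc m} k p n p≡0 =
  +ℝ-cong {n zero *ℝ embed k p zero} {0ℝ} {(n ∘ suc) ∙ embed (suc k) (p ∘ suc)} {0ℝ}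
    (≗⇒≈ℝ {n zero *ℝ embed k p zero} {0ℝ} λ j → trans
      (cong (λ r → seq (n zero) j ℚ.* (r ℚ.* seq (root k) j)) (p≡0 zero))
      (zeroed (seq (n zero) j) (seq (root k) j)))
    (embed-0-orthogonal (suc k) (p ∘ suc) (n ∘ suc) (p≡0 ∘ suc))
  where
  zeroed : ∀ p q → p ℚ.* (0ℚ ℚ.* q) ≡ 0ℚ
  zeroed = solve 2 (λ p q → p :* (con 0ℚ :* q) := con 0ℚ) refl

normSq-cong : ∀ {m} k {p q : Vector ℚ m} → p ≗ q → normSq k p ≡ normSq k q
normSq-cong {zero}  k p≗q = refl
normSq-cong {suc m} k p≗q = cong₂ (λ r s → r ℚ.* r ℚ.* weight k ℚ.+ s)
  (p≗q zero) (normSq-cong (suc k) (p≗q ∘ suc))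

normSq-0 : ∀ {m} k {p : Vector ℚ m} → (∀ c → p c ≡ 0ℚ) → normSq k p ≡ 0ℚ
normSq-0 {zero}  k p≡0 = refl
normSq-0 {suc m} k p≡0 = trans
  (cong₂ (λ r s → r ℚ.* r ℚ.* weight k ℚ.+ s) (p≡0 zero) (normSq-0 (suc k) (p≡0 ∘ suc)))
  (zeroed (weight k))
  where
  zeroed : ∀ w → 0ℚ ℚ.* 0ℚ ℚ.* w ℚ.+ 0ℚ ≡ 0ℚ
  zeroed = solve 1 (λ w → con 0ℚ :* con 0ℚ :* w :+ con 0ℚ := con 0ℚ) refl

normSq-neg : ∀ {m} k (p : Vector ℚ m) → normSq k (λ c → ℚ.- p c) ≡ normSq k p
normSq-neg {zero}  k p = refl
normSq-neg {suc m} k p = cong₂ (λ r s → r ℚ.* weight k ℚ.+ s)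
  (square-neg (p zero)) (normSq-neg (suc k) (p ∘ suc))

-- Vectors with squared length ½(1 + b) and pairwise inner product ½b, where
-- b = 1/(k+1). Splitting off the first one leaves such a system for k + 1.

direction : ∀ {m} → ℕ → Fin m → Vector ℚ m
direction k zero    zero    = 1ℚ
direction k zero    (suc c) = 0ℚ
-- With u = 1/(k + 2), the inner product with the first vector is u · ½(1 + b) = ½(b·u + u) = ½b, as
-- required.
direction k (suc i) zero    = unitFraction (suc k)
direction k (suc i) (suc c) = direction (suc k) i c

-- For a later direction, the first coordinate and the tail add up to u²·½(1 + b) + ½(1 + u), and
-- two uses of the recurrence for b turn this into ½(1 + b). Allowing any factor z, also a negative
-- one, covers differences of points on a ray.
normSq-ray : ∀ {m} k (i : Fin m) z →
             normSq k (λ c → z ℚ.* direction k i c) ≡ ½ ℚ.* (z ℚ.* z) ℚ.* (1ℚ ℚ.+ unitFraction k)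
normSq-ray {suc m} k zero z = trans
  (cong (z ℚ.* 1ℚ ℚ.* (z ℚ.* 1ℚ) ℚ.* weight k ℚ.+_) (normSq-0 {m} (suc k) λ _ → ℚ.*-zeroʳ z))
  (first z (unitFraction k))
  where
  first : ∀ z b → z ℚ.* 1ℚ ℚ.* (z ℚ.* 1ℚ) ℚ.* (½ ℚ.* (1ℚ ℚ.+ b)) ℚ.+ 0ℚ ≡ ½ ℚ.* (z ℚ.* z) ℚ.* (1ℚ ℚ.+ b)
  first = solve 2 (λ z b → z :* con 1ℚ :* (z :* con 1ℚ) :* (con ½ :* (con 1ℚ :+ b)) :+ con 0ℚ
    := con ½ :* (z :* z) :* (con 1ℚ :+ b)) refl
normSq-ray k (suc i) z = begin
  z ℚ.* u ℚ.* (z ℚ.* u) ℚ.* weight k ℚ.+ normSq (suc k) (λ c → z ℚ.* direction (suc k) i c)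
    ≡⟨ cong (z ℚ.* u ℚ.* (z ℚ.* u) ℚ.* weight k ℚ.+_) (normSq-ray (suc k) i z) ⟩
  z ℚ.* u ℚ.* (z ℚ.* u) ℚ.* weight k ℚ.+ ½ ℚ.* (z ℚ.* z) ℚ.* (1ℚ ℚ.+ u)
    ≡⟨ collect z b u ⟩
  ½ ℚ.* (z ℚ.* z) ℚ.* (1ℚ ℚ.+ (u ℚ.* (b ℚ.* u ℚ.+ u) ℚ.+ u))
    ≡⟨ cong (λ t → ½ ℚ.* (z ℚ.* z) ℚ.* (1ℚ ℚ.+ (u ℚ.* t ℚ.+ u))) (unitFraction-suc k) ⟩
  ½ ℚ.* (z ℚ.* z) ℚ.* (1ℚ ℚ.+ (u ℚ.* b ℚ.+ u))
    ≡⟨ cong (λ t → ½ ℚ.* (z ℚ.* z) ℚ.* (1ℚ ℚ.+ (t ℚ.+ u))) (ℚ.*-comm u b) ⟩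
  ½ ℚ.* (z ℚ.* z) ℚ.* (1ℚ ℚ.+ (b ℚ.* u ℚ.+ u))
    ≡⟨ cong (λ t → ½ ℚ.* (z ℚ.* z) ℚ.* (1ℚ ℚ.+ t)) (unitFraction-suc k) ⟩
  ½ ℚ.* (z ℚ.* z) ℚ.* (1ℚ ℚ.+ b) ∎
  where
  open ≡-Reasoning
  b = unitFraction k
  u = unitFraction (suc k)
  collect : ∀ z b u →
    z ℚ.* u ℚ.* (z ℚ.* u) ℚ.* (½ ℚ.* (1ℚ ℚ.+ b)) ℚ.+ ½ ℚ.* (z ℚ.* z) ℚ.* (1ℚ ℚ.+ u) ≡
    ½ ℚ.* (z ℚ.* z) ℚ.* (1ℚ ℚ.+ (u ℚ.* (b ℚ.* u ℚ.+ u) ℚ.+ u))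
  collect = solve 3 (λ z b u →
    z :* u :* (z :* u) :* (con ½ :* (con 1ℚ :+ b)) :+ con ½ :* (z :* z) :* (con 1ℚ :+ u) :=
    con ½ :* (z :* z) :* (con 1ℚ :+ (u :* (b :* u :+ u) :+ u))) refl

normSq-sameRay : ∀ {m} k (i : Fin m) x y →
  normSq k (λ c → x ℚ.* direction k i c ℚ.- y ℚ.* direction k i c) ≡
  ½ ℚ.* ((x ℚ.- y) ℚ.* (x ℚ.- y)) ℚ.* (1ℚ ℚ.+ unitFraction k)
normSq-sameRay k i x y = trans
  (normSq-cong k λ c → factor x y (direction k i c)) (normSq-ray k i (x ℚ.- y))
  where
  factor : ∀ x y e → x ℚ.* e ℚ.- y ℚ.* e ≡ (x ℚ.- y) ℚ.* e
  factor = solve 3 (λ x y e → x :* e :- y :* e := (x :- y) :* e) refl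

-- The law of cosines ½(1 + b)(x² + y²) - bxy, rearranged so that b occurs only once and can be
-- replaced in the induction. For k = 0 it is x² + y² - xy.
cosineLaw : ℕ → ℚ → ℚ → ℚ
cosineLaw k x y =
  ½ ℚ.* (x ℚ.* x ℚ.+ y ℚ.* y) ℚ.+ ½ ℚ.* ((x ℚ.- y) ℚ.* (x ℚ.- y)) ℚ.* unitFraction k

normSq-distinctRays : ∀ {m} k {i j : Fin m} → i ≢ j → ∀ x y →
  normSq k (λ c → x ℚ.* direction k i c ℚ.- y ℚ.* direction k j c) ≡ cosineLaw k x y
normSq-distinctRays k {zero} {zero} 0≢0 x y = ⊥-elim (0≢0 refl)
-- The first direction has zero tail, so the tail of the difference is -y times a later direction.
-- The recurrence for b is applied twice, with a rearrangement in between that exposes `b * u + u`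
-- again.
normSq-distinctRays k {zero} {suc j} _ x y = begin
  h ℚ.* h ℚ.* weight k ℚ.+ normSq (suc k) (λ c → x ℚ.* 0ℚ ℚ.- y ℚ.* direction (suc k) j c)
    ≡⟨ cong (h ℚ.* h ℚ.* weight k ℚ.+_) (trans
         (normSq-cong (suc k) λ c → negate x y (direction (suc k) j c)) (normSq-ray (suc k) j (ℚ.- y))) ⟩
  h ℚ.* h ℚ.* weight k ℚ.+ ½ ℚ.* (ℚ.- y ℚ.* ℚ.- y) ℚ.* (1ℚ ℚ.+ u)
    ≡⟨ collect₁ x y b u ⟩
  step₁ (b ℚ.* u ℚ.+ u)
    ≡⟨ cong step₁ (unitFraction-suc k) ⟩
  step₁ b
    ≡⟨ collect₂ x y b u ⟩
  step₂ (b ℚ.* u ℚ.+ u)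
    ≡⟨ cong step₂ (unitFraction-suc k) ⟩
  step₂ b
    ≡⟨ collect₃ x y b ⟩
  cosineLaw k x y ∎
  where
  open ≡-Reasoning
  b u h : ℚ
  b = unitFraction k
  u = unitFraction (suc k)
  h = x ℚ.* 1ℚ ℚ.- y ℚ.* u
  step₁ step₂ : ℚ → ℚ
  step₁ t = ½ ℚ.* (x ℚ.* x ℚ.* (1ℚ ℚ.+ b) ℚ.- (x ℚ.+ x) ℚ.* y ℚ.* t ℚ.+ y ℚ.* y ℚ.* (u ℚ.* t ℚ.+ 1ℚ ℚ.+ u))
  step₂ t = ½ ℚ.* (x ℚ.* x ℚ.* (1ℚ ℚ.+ b) ℚ.- (x ℚ.+ x) ℚ.* y ℚ.* b ℚ.+ y ℚ.* y ℚ.* (1ℚ ℚ.+ t))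
  negate : ∀ x y e → x ℚ.* 0ℚ ℚ.- y ℚ.* e ≡ ℚ.- y ℚ.* e
  negate = solve 3 (λ x y e → x :* con 0ℚ :- y :* e := :- y :* e) refl
  collect₁ : ∀ x y b u →
    (x ℚ.* 1ℚ ℚ.- y ℚ.* u) ℚ.* (x ℚ.* 1ℚ ℚ.- y ℚ.* u) ℚ.* (½ ℚ.* (1ℚ ℚ.+ b))
      ℚ.+ ½ ℚ.* (ℚ.- y ℚ.* ℚ.- y) ℚ.* (1ℚ ℚ.+ u) ≡
    ½ ℚ.* (x ℚ.* x ℚ.* (1ℚ ℚ.+ b) ℚ.- (x ℚ.+ x) ℚ.* y ℚ.* (b ℚ.* u ℚ.+ u)
      ℚ.+ y ℚ.* y ℚ.* (u ℚ.* (b ℚ.* u ℚ.+ u) ℚ.+ 1ℚ ℚ.+ u))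
  collect₁ = solve 4 (λ x y b u →
    (x :* con 1ℚ :- y :* u) :* (x :* con 1ℚ :- y :* u) :* (con ½ :* (con 1ℚ :+ b))
      :+ con ½ :* (:- y :* :- y) :* (con 1ℚ :+ u) :=
    con ½ :* (x :* x :* (con 1ℚ :+ b) :- (x :+ x) :* y :* (b :* u :+ u)
      :+ y :* y :* (u :* (b :* u :+ u) :+ con 1ℚ :+ u))) refl
  collect₂ : ∀ x y b u →
    ½ ℚ.* (x ℚ.* x ℚ.* (1ℚ ℚ.+ b) ℚ.- (x ℚ.+ x) ℚ.* y ℚ.* b ℚ.+ y ℚ.* y ℚ.* (u ℚ.* b ℚ.+ 1ℚ ℚ.+ u)) ≡
    ½ ℚ.* (x ℚ.* x ℚ.* (1ℚ ℚ.+ b) ℚ.- (x ℚ.+ x) ℚ.* y ℚ.* b ℚ.+ y ℚ.* y ℚ.* (1ℚ ℚ.+ (b ℚ.* u ℚ.+ u)))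
  collect₂ = solve 4 (λ x y b u →
    con ½ :* (x :* x :* (con 1ℚ :+ b) :- (x :+ x) :* y :* b :+ y :* y :* (u :* b :+ con 1ℚ :+ u)) :=
    con ½ :* (x :* x :* (con 1ℚ :+ b) :- (x :+ x) :* y :* b :+ y :* y :* (con 1ℚ :+ (b :* u :+ u)))) refl
  collect₃ : ∀ x y b →
    ½ ℚ.* (x ℚ.* x ℚ.* (1ℚ ℚ.+ b) ℚ.- (x ℚ.+ x) ℚ.* y ℚ.* b ℚ.+ y ℚ.* y ℚ.* (1ℚ ℚ.+ b)) ≡
    ½ ℚ.* (x ℚ.* x ℚ.+ y ℚ.* y) ℚ.+ ½ ℚ.* ((x ℚ.- y) ℚ.* (x ℚ.- y)) ℚ.* b
  collect₃ = solve 3 (λ x y b →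
    con ½ :* (x :* x :* (con 1ℚ :+ b) :- (x :+ x) :* y :* b :+ y :* y :* (con 1ℚ :+ b)) :=
    con ½ :* (x :* x :+ y :* y) :+ con ½ :* ((x :- y) :* (x :- y)) :* b) refl
normSq-distinctRays k {suc i} {zero} _ x y = begin
  normSq k (λ c → x ℚ.* direction k (suc i) c ℚ.- y ℚ.* direction k zero c)
    ≡⟨ normSq-cong k (λ c → swap (x ℚ.* direction k (suc i) c) (y ℚ.* direction k zero c)) ⟩
  normSq k (λ c → ℚ.- (y ℚ.* direction k zero c ℚ.- x ℚ.* direction k (suc i) c))
    ≡⟨ normSq-neg k (λ c → y ℚ.* direction k zero c ℚ.- x ℚ.* direction k (suc i) c) ⟩
  normSq k (λ c → y ℚ.* direction k zero c ℚ.- x ℚ.* direction k (suc i) c)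
    ≡⟨ normSq-distinctRays k {zero} {suc i} (λ ()) y x ⟩
  cosineLaw k y x
    ≡⟨ symmetric x y (unitFraction k) ⟩
  cosineLaw k x y ∎
  where
  open ≡-Reasoning
  swap : ∀ p q → p ℚ.- q ≡ ℚ.- (q ℚ.- p)
  swap = solve 2 (λ p q → p :- q := :- (q :- p)) refl
  symmetric : ∀ x y b →
    ½ ℚ.* (y ℚ.* y ℚ.+ x ℚ.* x) ℚ.+ ½ ℚ.* ((y ℚ.- x) ℚ.* (y ℚ.- x)) ℚ.* b ≡
    ½ ℚ.* (x ℚ.* x ℚ.+ y ℚ.* y) ℚ.+ ½ ℚ.* ((x ℚ.- y) ℚ.* (x ℚ.- y)) ℚ.* b
  symmetric = solve 3 (λ x y b →
    con ½ :* (y :* y :+ x :* x) :+ con ½ :* ((y :- x) :* (y :- x)) :* b :=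
    con ½ :* (x :* x :+ y :* y) :+ con ½ :* ((x :- y) :* (x :- y)) :* b) refl
-- Both directions have first coordinate u, which adds ½(x - y)²·u²(1 + b) to the inductive value.
-- The result follows from u²(1 + b) + u = b.
normSq-distinctRays k {suc i} {suc j} i≢j x y = begin
  h ℚ.* h ℚ.* weight k ℚ.+ normSq (suc k) (λ c → x ℚ.* direction (suc k) i c ℚ.- y ℚ.* direction (suc k) j c)
    ≡⟨ cong (h ℚ.* h ℚ.* weight k ℚ.+_) (normSq-distinctRays (suc k) (i≢j ∘ cong suc) x y) ⟩
  h ℚ.* h ℚ.* weight k ℚ.+ cosineLaw (suc k) x y
    ≡⟨ collect x y b u ⟩
  law (u ℚ.* (b ℚ.* u ℚ.+ u) ℚ.+ u)
    ≡⟨ cong (λ t → law (u ℚ.* t ℚ.+ u)) (unitFraction-suc k) ⟩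
  law (u ℚ.* b ℚ.+ u)
    ≡⟨ cong (λ t → law (t ℚ.+ u)) (ℚ.*-comm u b) ⟩
  law (b ℚ.* u ℚ.+ u)
    ≡⟨ cong law (unitFraction-suc k) ⟩
  law b ∎
  where
  open ≡-Reasoning
  b u h : ℚ
  b = unitFraction k
  u = unitFraction (suc k)
  h = x ℚ.* u ℚ.- y ℚ.* u
  law : ℚ → ℚ
  law t = ½ ℚ.* (x ℚ.* x ℚ.+ y ℚ.* y) ℚ.+ ½ ℚ.* ((x ℚ.- y) ℚ.* (x ℚ.- y)) ℚ.* t
  collect : ∀ x y b u →
    (x ℚ.* u ℚ.- y ℚ.* u) ℚ.* (x ℚ.* u ℚ.- y ℚ.* u) ℚ.* (½ ℚ.* (1ℚ ℚ.+ b))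
      ℚ.+ (½ ℚ.* (x ℚ.* x ℚ.+ y ℚ.* y) ℚ.+ ½ ℚ.* ((x ℚ.- y) ℚ.* (x ℚ.- y)) ℚ.* u) ≡
    ½ ℚ.* (x ℚ.* x ℚ.+ y ℚ.* y)
      ℚ.+ ½ ℚ.* ((x ℚ.- y) ℚ.* (x ℚ.- y)) ℚ.* (u ℚ.* (b ℚ.* u ℚ.+ u) ℚ.+ u)
  collect = solve 4 (λ x y b u →
    (x :* u :- y :* u) :* (x :* u :- y :* u) :* (con ½ :* (con 1ℚ :+ b))
      :+ (con ½ :* (x :* x :+ y :* y) :+ con ½ :* ((x :- y) :* (x :- y)) :* u) :=
    con ½ :* (x :* x :+ y :* y)
      :+ con ½ :* ((x :- y) :* (x :- y)) :* (u :* (b :* u :+ u) :+ u)) refl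

-- The system is triangular. The first direction has only its first coordinate nonzero, which forces
-- the first entry of `n` to vanish; that entry then drops out of the other equations, leaving the
-- same system at `suc k`.
directions-span : ∀ {m} k z .{{_ : ℚ.NonZero z}} (n : Vector ℝ m) →
  (∀ i → n ∙ embed k (λ c → z ℚ.* direction k i c) ≈ℝ 0ℝ) → n ≋ λ _ → 0ℝ
directions-span {suc m} k z n n⊥ = λ where
    zero    → n₀≈0
    (suc c) → directions-span (suc k) z (n ∘ suc) tail⊥ c
  where
  instance
    w-pos : ℚ.Positive (weight k)
    w-pos = ℚ.positive (0<weight k)
    w-nz : ℚ.NonZero (weight k)
    w-nz = ℚ.pos⇒nonZero (weight k)
  s n₀ pivot : ℝ
  s = root k
  n₀ = n zero
  pivot = fromℚ (z ℚ.* 1ℚ) *ℝ s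
  z⁻¹ w⁻¹ : ℚ
  z⁻¹ = ℚ.1/ z
  w⁻¹ = ℚ.1/ weight k
  0s : Vector ℚ m
  0s _ = z ℚ.* 0ℚ
  n₀*pivot≈0 : n₀ *ℝ pivot ≈ℝ 0ℝ
  n₀*pivot≈0 = +ℝ-cancelʳ {n₀ *ℝ pivot} {(n ∘ suc) ∙ embed (suc k) 0s} {0ℝ}
    (embed-0-orthogonal (suc k) 0s (n ∘ suc) λ _ → ℚ.*-zeroʳ z) (n⊥ zero)
  -- Since 1/√w = √w/w, the inverse of z√w needs only rational reciprocals.
  pivot⁻¹ : ℝ
  pivot⁻¹ = fromℚ (z⁻¹ ℚ.* w⁻¹) *ℝ s
  group : ∀ x z z⁻¹ w⁻¹ s → x ℚ.* (z ℚ.* 1ℚ ℚ.* s) ℚ.* (z⁻¹ ℚ.* w⁻¹ ℚ.* s) ≡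
                            x ℚ.* (z ℚ.* z⁻¹) ℚ.* (w⁻¹ ℚ.* (s ℚ.* s))
  group = solve 5 (λ x z z⁻¹ w⁻¹ s → x :* (z :* con 1ℚ :* s) :* (z⁻¹ :* w⁻¹ :* s) :=
                                     x :* (z :* z⁻¹) :* (w⁻¹ :* (s :* s))) refl
  recover : ∀ x → x ℚ.* (z ℚ.* z⁻¹) ℚ.* (w⁻¹ ℚ.* weight k) ≡ x
  recover x = trans (cong₂ (λ p q → x ℚ.* p ℚ.* q) (ℚ.*-inverseʳ z) (ℚ.*-inverseˡ (weight k)))
    (trans (ℚ.*-identityʳ (x ℚ.* 1ℚ)) (ℚ.*-identityʳ x))
  y : ℝ
  y = n₀ *ℝ fromℚ (z ℚ.* z⁻¹)
  n₀≈0 : n₀ ≈ℝ 0ℝ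
  n₀≈0 =
    ≈ℝ-trans {n₀} {y *ℝ (fromℚ w⁻¹ *ℝ fromℚ (weight k))} {0ℝ}
      (≗⇒≈ℝ {n₀} {y *ℝ (fromℚ w⁻¹ *ℝ fromℚ (weight k))} λ j → sym (recover (seq n₀ j)))
    (≈ℝ-trans {y *ℝ (fromℚ w⁻¹ *ℝ fromℚ (weight k))} {y *ℝ (fromℚ w⁻¹ *ℝ (s *ℝ s))} {0ℝ}
      (*ℝ-cong {y} {y} {fromℚ w⁻¹ *ℝ fromℚ (weight k)} {fromℚ w⁻¹ *ℝ (s *ℝ s)} (≈ℝ-refl {y})
        (*ℝ-cong {fromℚ w⁻¹} {fromℚ w⁻¹} {fromℚ (weight k)} {s *ℝ s} (≈ℝ-refl {fromℚ w⁻¹})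
          (≈ℝ-sym {s *ℝ s} {fromℚ (weight k)} (root*root k))))
    (≈ℝ-trans {y *ℝ (fromℚ w⁻¹ *ℝ (s *ℝ s))} {n₀ *ℝ pivot *ℝ pivot⁻¹} {0ℝ}
      (≗⇒≈ℝ {y *ℝ (fromℚ w⁻¹ *ℝ (s *ℝ s))} {n₀ *ℝ pivot *ℝ pivot⁻¹} λ j →
        sym (group (seq n₀ j) z z⁻¹ w⁻¹ (seq s j)))
      (*ℝ-zeroˡ {n₀ *ℝ pivot} {pivot⁻¹} n₀*pivot≈0)))
  tail⊥ : ∀ i → (n ∘ suc) ∙ embed (suc k) (λ c → z ℚ.* direction (suc k) i c) ≈ℝ 0ℝ
  tail⊥ i = +ℝ-cancelˡ {n₀ *ℝ (fromℚ (z ℚ.* unitFraction (suc k)) *ℝ s)}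
    {(n ∘ suc) ∙ embed (suc k) (λ c → z ℚ.* direction (suc k) i c)} {0ℝ}
    (*ℝ-zeroˡ {n₀} {fromℚ (z ℚ.* unitFraction (suc k)) *ℝ s} n₀≈0) (n⊥ (suc i))

-- Integers among the reals, and distances

fromℤ-mono-≤ : ∀ {j k} → j ℤ.≤ k → fromℤ j ≤ℝ fromℤ k
fromℤ-mono-≤ {j} {k} j≤k = fromℚ-mono-≤ (ℚ.toℚᵘ-cancel-≤ (begin
  ℚ.toℚᵘ (j ℚ./ 1)  ≃⟨ ℚ.toℚᵘ-fromℚᵘ (ℚᵘ.mkℚᵘ j 0) ⟩
  ℚᵘ.mkℚᵘ j 0       ≤⟨ ℚᵘ.*≤* (ℤ.*-monoʳ-≤-nonNeg (+ 1) j≤k) ⟩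
  ℚᵘ.mkℚᵘ k 0       ≃⟨ ℚ.toℚᵘ-fromℚᵘ (ℚᵘ.mkℚᵘ k 0) ⟨
  ℚ.toℚᵘ (k ℚ./ 1)  ∎))
  where open ℚᵘ.≤-Reasoning

fromℕ : ℕ → ℚ
fromℕ n = + n ℚ./ 1

fromℕ²≡0⇒≡0 : ∀ n → fromℕ n ℚ.* fromℕ n ≡ 0ℚ → n ≡ 0
fromℕ²≡0⇒≡0 zero    _  = refl
fromℕ²≡0⇒≡0 (suc n) eq = ⊥-elim (ℚ.<-irrefl (sym eq) (0<p*q 0<n 0<n))
  where
  0<n : 0ℚ ℚ.< fromℕ (suc n)
  0<n = ℚ.positive⁻¹ (fromℕ (suc n)) {{ℚ.normalize-pos (suc n) 1}}

fromℤ-∣∣² : ∀ k → fromℤ k *ℝ fromℤ k ≈ℝ fromℤ (+ ℤ.∣ k ∣) *ℝ fromℤ (+ ℤ.∣ k ∣)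
fromℤ-∣∣² (+ n) = ≈ℝ-refl {fromℤ (+ n) *ℝ fromℤ (+ n)}
fromℤ-∣∣² -[1+ n ] =
  ≗⇒≈ℝ {fromℤ -[1+ n ] *ℝ fromℤ -[1+ n ]} {fromℤ +[1+ n ] *ℝ fromℤ +[1+ n ]}
    λ _ → square-neg (fromℕ (suc n))

-- Both squares equal `v ∙ v`, and `s` is nonnegative. Used in both directions, this gives
-- uniqueness of distances.
IsDistance-≤ : ∀ {m} {p q : Vector ℝ m} {r s} → IsDistance p q r → IsDistance p q s → r ≤ℝ s
IsDistance-≤ {p = p} {q} {r} {s} (_ , rr≈) (0≤s , ss≈) = square-cancel-≤ℝ {r} {s} 0≤s
  (≈ℝ⇒≤ℝ {r *ℝ r} {s *ℝ s} (≈ℝ-trans {r *ℝ r} {v ∙ v} {s *ℝ s} rr≈ (≈ℝ-sym {s *ℝ s} {v ∙ v} ss≈)))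
  where v = zipWith _-ℝ_ p q

-- The absolute value has the same square as `k` and is nonnegative by construction.
IsDistance-∣∣ : ∀ {m} {p q : Vector ℝ m} k → IsDistance p q (fromℤ k) → IsDistance p q (fromℤ (+ ℤ.∣ k ∣))
IsDistance-∣∣ {p = p} {q} k (_ , kk≈) = fromℤ-mono-≤ {+ 0} {+ ℤ.∣ k ∣} (ℤ.+≤+ ℕ.z≤n) ,
  ≈ℝ-trans {∣k∣ *ℝ ∣k∣} {fromℤ k *ℝ fromℤ k} {v ∙ v}
    (≈ℝ-sym {fromℤ k *ℝ fromℤ k} {∣k∣ *ℝ ∣k∣} (fromℤ-∣∣² k)) kk≈
  where
  v = zipWith _-ℝ_ p q
  ∣k∣ = fromℤ (+ ℤ.∣ k ∣)

-- Minimal diameters exist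

-- Strong induction: excluded middle decides whether a smaller number satisfies `P`, and if none
-- does, `n` itself is least. The bound `k ≤ n` later yields the upper bound on the minimal
-- diameter.
least : ExcludedMiddle 0ℓ → (P : ℕ → Set) → ∀ n → P n →
        ∃[ k ] (P k × k ≤ n × ∀ j → P j → k ≤ j)
least em P = <-rec _ λ n smaller Pn → search n smaller Pn
  where
  search : ∀ n → (∀ {j} → j ℕ.< n → P j → ∃[ k ] (P k × k ≤ j × ∀ i → P i → k ≤ i)) → P n →
           ∃[ k ] (P k × k ≤ n × ∀ i → P i → k ≤ i)
  search n smaller Pn with em {∃[ j ] (j ℕ.< n × P j)}
  ... | no none = n , Pn , ℕ.≤-refl , λ j Pj → ℕ.≮⇒≥ λ j<n → none (j , j<n , Pj)
  ... | yes (j , j<n , Pj) =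
    let k , Pk , k≤j , minimal = smaller j<n Pj
    in k , Pk , ℕ.≤-trans k≤j (ℕ.<⇒≤ j<n) , minimal

-- Diameters are indexed by natural numbers so that `least` applies; `natural-diameter` shows that
-- no real diameter is lost.
HasDiameter : ℕ → ℕ → ℕ → Set
HasDiameter m n k =
  Σ[ P ∈ (Fin n → Vector ℝ m) ] (IsIntegralPointSet P × IsDiameter P (fromℤ (+ k)))

-- The diameter is attained at some pair, whose distance is also an integer; by uniqueness of
-- distances the absolute value of that integer can replace ε.
natural-diameter : ∀ {m n} (P : Fin n → Vector ℝ m) ε → IsIntegralPointSet P → IsDiameter P ε →
                   ∃[ k ] (HasDiameter m n k × fromℤ (+ k) ≤ℝ ε)
natural-diameter P ε integral-P diam =
  let i , j , dist-ε = IsDiameter.attained diam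
      k , dist-k     = IsIntegralPointSet.integral integral-P i j
      dist-∣k∣       = IsDistance-∣∣ {p = P i} {P j} k dist-k
      ∣k∣            = fromℤ (+ ℤ.∣ k ∣)
  in ℤ.∣ k ∣ , (P , integral-P , record
       { attained = i , j , dist-∣k∣
       ; maximal  = λ i′ j′ r dist-r → ≤ℝ-trans {r} {ε} {∣k∣}
           (IsDiameter.maximal diam i′ j′ r dist-r)
           (IsDistance-≤ {p = P i} {P j} {ε} {∣k∣} dist-ε dist-∣k∣) }) ,
     IsDistance-≤ {p = P i} {P j} {∣k∣} {ε} dist-∣k∣ dist-ε

minimalDiameter≤ : ExcludedMiddle 0ℓ → ∀ {m n d} → HasDiameter m n d →
                   ∃[ δ ] (IsMinimalDiameter m n δ × δ ≤ℝ fromℤ (+ d))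
minimalDiameter≤ em {m} {n} {d} has-d =
  let k , (P , integral-P , diam) , k≤d , minimal = least em (HasDiameter m n) d has-d
  in fromℤ (+ k) , record
       { attained = P , integral-P , diam
       ; minimal  = λ Q ε integral-Q diam-ε →
           let j , has-j , j≤ε = natural-diameter Q ε integral-Q diam-ε
           in ≤ℝ-trans {fromℤ (+ k)} {fromℤ (+ j)} {ε}
                (fromℤ-mono-≤ (ℤ.+≤+ (minimal j has-j))) j≤ε
       } , fromℤ-mono-≤ (ℤ.+≤+ k≤d)

-- The point set

radius : Fin 4 → ℕ
radius = lookup (0 ∷ 7 ∷ 15 ∷ 40 ∷ [])

-- √(a² + b² − ab) for the radii a and b, of which the first, 0, is that of the apex
chord : Fin 4 → Fin 4 → ℕ
chord t s = lookup (lookup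
  ( ( 0 ∷  7 ∷ 15 ∷ 40 ∷ [])
  ∷ ( 7 ∷  7 ∷ 13 ∷ 37 ∷ [])
  ∷ (15 ∷ 13 ∷ 15 ∷ 35 ∷ [])
  ∷ (40 ∷ 37 ∷ 35 ∷ 40 ∷ [])
  ∷ []) t) s

radiusℚ : Fin 4 → ℚ
radiusℚ t = fromℕ (radius t)

point : ∀ {m} → Fin 4 × Fin m → Vector ℝ m
point (t , i) = embed 0 (λ c → radiusℚ t ℚ.* direction 0 i c)

distance : ∀ {m} → Fin 4 × Fin m → Fin 4 × Fin m → ℕ
distance (t , i) (s , j) with i Fin.≟ j
... | yes _ = ℕ.∣ radius t - radius s ∣
... | no  _ = chord t s

-- At k = 0 we have b = 1, so the directions are unit vectors at 60° to each other. What remains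
-- depends only on the two radii, and all 16 cases are decided by computation.
distance² : ∀ {m} (a b : Fin 4 × Fin m) →
  normSq 0 (λ c → radiusℚ (proj₁ a) ℚ.* direction 0 (proj₂ a) c
              ℚ.- radiusℚ (proj₁ b) ℚ.* direction 0 (proj₂ b) c) ≡
  fromℕ (distance a b) ℚ.* fromℕ (distance a b)
distance² (t , i) (s , j) with i Fin.≟ j
... | yes refl = trans (normSq-sameRay 0 i (radiusℚ t) (radiusℚ s)) (sameRay t s)
  where
  lhs rhs : Fin 4 → Fin 4 → ℚ
  lhs t s = ½ ℚ.* ((radiusℚ t ℚ.- radiusℚ s) ℚ.* (radiusℚ t ℚ.- radiusℚ s)) ℚ.* (1ℚ ℚ.+ unitFraction 0)
  rhs t s = fromℕ ℕ.∣ radius t - radius s ∣ ℚ.* fromℕ ℕ.∣ radius t - radius s ∣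
  sameRay : ∀ t s → lhs t s ≡ rhs t s
  sameRay = from-yes (Fin.all? λ t → Fin.all? λ s → lhs t s ℚ.≟ rhs t s)
... | no i≢j = trans (normSq-distinctRays 0 i≢j (radiusℚ t) (radiusℚ s)) (distinctRays t s)
  where
  distinctRays : ∀ t s → cosineLaw 0 (radiusℚ t) (radiusℚ s) ≡ fromℕ (chord t s) ℚ.* fromℕ (chord t s)
  distinctRays = from-yes (Fin.all? λ t → Fin.all? λ s →
    cosineLaw 0 (radiusℚ t) (radiusℚ s) ℚ.≟ fromℕ (chord t s) ℚ.* fromℕ (chord t s))

distance-isDistance : ∀ {m} (a b : Fin 4 × Fin m) →
  IsDistance (point a) (point b) (fromℤ (+ distance a b))
distance-isDistance a@(t , i) b@(s , j) = fromℤ-mono-≤ {+ 0} {+ d} (ℤ.+≤+ ℕ.z≤n) ,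
  ≈ℝ-sym {v ∙ v} {fromℤ (+ d) *ℝ fromℤ (+ d)}
    (≈ℝ-trans {v ∙ v} {fromℚ n²} {fromℤ (+ d) *ℝ fromℤ (+ d)}
      (embed-distSq 0 p q)
      (≗⇒≈ℝ {fromℚ n²} {fromℤ (+ d) *ℝ fromℤ (+ d)} λ _ → distance² a b))
  where
  d = distance a b
  p q : Vector ℚ _
  p c = radiusℚ t ℚ.* direction 0 i c
  q c = radiusℚ s ℚ.* direction 0 j c
  n² = normSq 0 (zipWith ℚ._-_ p q)
  v = zipWith _-ℝ_ (point a) (point b)

distance≤40 : ∀ {m} (a b : Fin 4 × Fin m) → distance a b ≤ 40
distance≤40 (t , i) (s , j) with i Fin.≟ j
... | yes _ = sameRay t s
  where
  sameRay : ∀ t s → ℕ.∣ radius t - radius s ∣ ≤ 40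
  sameRay = from-yes (Fin.all? λ t → Fin.all? λ s → ℕ.∣ radius t - radius s ∣ ℕ.≤? 40)
... | no _ = distinctRays t s
  where
  distinctRays : ∀ t s → chord t s ≤ 40
  distinctRays = from-yes (Fin.all? λ t → Fin.all? λ s → chord t s ℕ.≤? 40)

-- Every pair with radius index 0 denotes the apex, so the apex gets a single label, on an
-- arbitrarily chosen ray, and the other labels use the three positive radii.
label : ∀ {m} → (Fin 3 × Fin (suc m)) ⊎ Fin 1 → Fin 4 × Fin (suc m)
label (inj₁ (t , i)) = suc t , i
label (inj₂ _)       = zero , zero

-- Distance 0 forces equal radii, by inspection of the tables, so the apex is separated from all
-- other points. Two points of equal positive radius on different rays have a positive chord, so the
-- rays agree too.
distance≡0 : ∀ {m} (a b : (Fin 3 × Fin (suc m)) ⊎ Fin 1) → distance (label a) (label b) ≡ 0 → a ≡ b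
distance≡0 a b d≡0 = separate a b (radii a b d≡0) d≡0
  where
  sameRay : ∀ t s → ℕ.∣ radius t - radius s ∣ ≡ 0 → t ≡ s
  sameRay = from-yes (Fin.all? λ t → Fin.all? λ s →
    (ℕ.∣ radius t - radius s ∣ ℕ.≟ 0) →-dec (t Fin.≟ s))
  distinctRays : ∀ t s → chord t s ≡ 0 → t ≡ s
  distinctRays = from-yes (Fin.all? λ t → Fin.all? λ s → (chord t s ℕ.≟ 0) →-dec (t Fin.≟ s))
  chord≢0 : ∀ (t : Fin 3) → chord (suc t) (suc t) ≢ 0
  chord≢0 zero             ()
  chord≢0 (suc zero)       ()
  chord≢0 (suc (suc zero)) ()
  radii : ∀ {m} (a b : (Fin 3 × Fin (suc m)) ⊎ Fin 1) → distance (label a) (label b) ≡ 0 →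
          proj₁ (label a) ≡ proj₁ (label b)
  radii a b d≡0 with proj₂ (label a) Fin.≟ proj₂ (label b)
  ... | yes _ = sameRay _ _ d≡0
  ... | no  _ = distinctRays _ _ d≡0
  separate : ∀ {m} (a b : (Fin 3 × Fin (suc m)) ⊎ Fin 1) → proj₁ (label a) ≡ proj₁ (label b) →
             distance (label a) (label b) ≡ 0 → a ≡ b
  separate (inj₂ zero)    (inj₂ zero)     _    _   = refl
  separate (inj₁ (t , i)) (inj₁ (.t , j)) refl d≡0 with i Fin.≟ j
  ... | yes refl = refl
  ... | no  _    = ⊥-elim (chord≢0 t d≡0)

-- Enumeration of the points, and the properties of the resulting set

index : ∀ m → Fin (3 * m + 1) ↔ ((Fin 3 × Fin m) ⊎ Fin 1)
index m = (Fin.*↔× ⊎-↔ ↔-id (Fin 1)) ↔-∘ Fin.+↔⊎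

points : ∀ m → Fin (3 * suc m + 1) → Vector ℝ (suc m)
points m = point ∘ label ∘ Inverse.to (index (suc m))

points-label : ∀ m (Q : Vector ℝ (suc m) → Set) → (∀ k → Q (points m k)) → ∀ a → Q (point (label a))
points-label m Q all a =
  subst (Q ∘ point ∘ label) (Inverse.strictlyInverseˡ (index (suc m)) a)
    (all (Inverse.from (index (suc m)) a))

-- Coinciding points have squared distance 0 in the reals, hence in ℚ, so their natural-number
-- distance is 0 and `distance≡0` applies.
points-distinct : ∀ {m} (a b : (Fin 3 × Fin (suc m)) ⊎ Fin 1) → point (label a) ≋ point (label b) → a ≡ b
points-distinct a b a≋b = distance≡0 a b (fromℕ²≡0⇒≡0 d (fromℚ-injective
  (≈ℝ-trans {fromℤ (+ d) *ℝ fromℤ (+ d)} {v ∙ v} {0ℝ} (proj₂ (distance-isDistance (label a) (label b)))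
    (distSq-cong-0 (point (label a)) (point (label b)) a≋b))))
  where
  d = distance (label a) (label b)
  v = zipWith _-ℝ_ (point (label a)) (point (label b))

-- The apex is the origin, so the offset vanishes. The normal vector is then orthogonal to the
-- points of radius 40 on all rays, and these span the space.
points-notHyperplane : ∀ m → ¬ (Σ[ H ∈ Hyperplane (suc m) ] ∀ k → points m k ∈ᴴ H)
points-notHyperplane m (H , ∈H) = normal≉0
  (directions-span 0 (radiusℚ 3F) normal λ i →
    -- `label` shifts the radius index by one, so `2F` in the label gives the radius with index
    -- `3F`.
    ≈ℝ-trans {normal ∙ point (3F , i)} {offset} {0ℝ} (label∈H (inj₁ (2F , i))) offset≈0)
  where
  open Hyperplane H
  label∈H : ∀ a → point (label a) ∈ᴴ H
  label∈H = points-label m (_∈ᴴ H) ∈H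
  apex : Vector ℝ (suc m)
  apex = point (0F , 0F)
  offset≈0 : offset ≈ℝ 0ℝ
  offset≈0 = ≈ℝ-trans {offset} {normal ∙ apex} {0ℝ}
    (≈ℝ-sym {normal ∙ apex} {offset} (label∈H (inj₂ 0F)))
    (embed-0-orthogonal 0 (λ c → 0ℚ ℚ.* direction 0 0F c) normal λ c → ℚ.*-zeroˡ (direction 0 0F c))

points-hasDiameter : ∀ m → HasDiameter (suc m) (3 * suc m + 1) 40
points-hasDiameter m = points m
  , record
    { distinct      = λ {i} {j} pᵢ≋pⱼ → Injection.injective (↔⇒↣ (index (suc m)))
        (points-distinct (to i) (to j) pᵢ≋pⱼ)
    ; integral      = λ i j → + distance (label (to i)) (label (to j)) ,
        distance-isDistance (label (to i)) (label (to j))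
    ; notHyperplane = points-notHyperplane m }
  , record
    -- The apex and the outermost point of the first ray are |0 - 40| = 40 apart.
    { attained = from (inj₂ 0F) , from (inj₁ (2F , 0F)) ,
        subst₂ (λ a b → IsDistance (point (label a)) (point (label b)) (fromℤ (+ 40)))
          (sym (strictlyInverseˡ (inj₂ 0F))) (sym (strictlyInverseˡ (inj₁ (2F , 0F))))
          (distance-isDistance apex far)
    ; maximal  = λ i j r dist-r →
        let a = label (to i) ; b = label (to j) ; d = distance a b in
        ≤ℝ-trans {r} {fromℤ (+ d)} {fromℤ (+ 40)}
          (IsDistance-≤ {p = point a} {point b} {r} {fromℤ (+ d)} dist-r (distance-isDistance a b))
          (fromℤ-mono-≤ (ℤ.+≤+ (distance≤40 a b))) }
  where
  open Inverse (index (suc m)) using (to; from; strictlyInverseˡ)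
  apex far : Fin 4 × Fin (suc m)
  apex = 0F , 0F
  far  = 3F , 0F

mainTheorem5 : ExcludedMiddle 0ℓ → ∀ (m : ℕ) → 2 ≤ m →
    ∃[ δ ] (IsMinimalDiameter m (3 * m + 1) δ × δ ≤ℝ fromℤ (+ 56))
mainTheorem5 em (suc m) _ =
  let δ , minimal , δ≤40 = minimalDiameter≤ em {d = 40} (points-hasDiameter m)
  -- The construction gives the bound 40, and 40 + 16 = 56.
  in δ , minimal , ≤ℝ-trans {δ} {fromℤ (+ 40)} {fromℤ (+ 56)} δ≤40 (fromℤ-mono-≤ (ℤ.+≤+ (ℕ.m≤m+n 40 16)))
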